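{- Let $K$ be a finite simple connected graph with $n$ vertices, where $n\ge 5$, such that $K$ is isomorphic neither to the $n$-vertex path $P_n$ nor to the $n$-vertex cycle $C_n$. If $G$ is the line graph of $K$, then $$ABS(G)>ABC(G).$$
   Context: For a finite simple graph $G$ with edge set $\mathbf{E}(G)$, let $d_u$ denote the degree of the vertex $u$ in $G$. The atom-bond-connectivity index is $ABC(G)=\sum_{uv\in \mathbf{E}(G)}\sqrt{\frac{d_u+d_v-2}{d_u d_v}}$ and the atom-bond sum-connectivity index is $ABS(G)=\sum_{uv\in \mathbf{E}(G)}\sqrt{\frac{d_u+d_v-2}{d_u+d_v}}$. The line graph of $K$ is the graph whose vertices are the edges of $K$, two of them being adjacent if and only if they are distinct and share an endpoint in $K$. -}

module Defs where

open import Data.Empty using (⊥-elim)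
open import Data.Fin as Fin using (Fin; toℕ)
import Data.Fin.Properties as Finₚ
open import Data.Integer as ℤ using (+_)
import Data.Integer.Properties as ℤₚ
open import Data.List.Base using (List; length; filter; map; foldr; lookup; allFin; cartesianProduct)
open import Data.Nat as ℕ using (ℕ; zero; suc)
import Data.Nat.Properties as ℕₚ
open import Data.Product using (_×_; _,_; ∃; ∃-syntax; Σ-syntax)
open import Data.Rational
  using (ℚ; mkℚ; 0ℚ; 1ℚ; ½; _+_; _*_; -_; _-_; _<_; _≤_; _/_; _⊔_; _⊓_; 1/_; *<*;
         positive; nonNegative)
import Data.Rational.Properties as ℚₚ
open import Data.Rational.Solver using (module +-*-Solver)
open import Data.Sum using (_⊎_; inj₁; inj₂; swap; [_,_]′)
open import Function.Bundles using (_↔_; _⇔_; Inverse)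
open import Level using (0ℓ)
open import Relation.Binary.Construct.Closure.ReflexiveTransitive using (Star)
open import Relation.Binary.Core using (Rel)
open import Relation.Binary.Definitions using (Decidable; Symmetric; Irreflexive; tri<; tri≈; tri>)
open import Relation.Binary.PropositionalEquality
  using (_≡_; _≢_; refl; sym; trans; cong; subst; subst₂; ≢-sym)
open import Relation.Nullary using (¬_; yes; no)
open import Relation.Nullary.Decidable using (_×-dec_; _⊎-dec_; ¬?)
open import Relation.Unary using (Pred)

-- Real numbers are two-sided Dedekind cuts of ℚ.
record ℝ : Set₁ where
  field
    L U         : Pred ℚ 0ℓ
    L-inhabited : ∃ L
    U-inhabited : ∃ U
    L-lower     : ∀ {p q} → p < q → L q → L p
    U-upper     : ∀ {p q} → p < q → U p → U q
    L-open      : ∀ {p} → L p → ∃[ q ] (p < q × L q)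
    U-open      : ∀ {q} → U q → ∃[ p ] (p < q × U p)
    disjoint    : ∀ {q} → L q → ¬ U q
    located     : ∀ {p q} → p < q → L p ⊎ U q

open ℝ

infix 4 _<ℝ_
_<ℝ_ : ℝ → ℝ → Set
x <ℝ y = ∃[ q ] (U x q × L y q)

private
  open +-*-Solver

  0<⇒< : ∀ {p q} → 0ℚ < q - p → p < q
  0<⇒< {p} {q} h = subst₂ _<_ (ℚₚ.+-identityˡ p)
    (solve 2 (λ p q → (q :- p) :+ p := q) refl p q) (ℚₚ.+-monoˡ-< p h)

  <⇒0< : ∀ {p q} → p < q → 0ℚ < q - p
  <⇒0< {p} {q} h = subst (_< (q - p)) (ℚₚ.+-inverseʳ p) (ℚₚ.+-monoˡ-< (- p) h)

  0≤⇒≤ : ∀ {p q} → 0ℚ ≤ q - p → p ≤ q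
  0≤⇒≤ {p} {q} h = subst₂ _≤_ (ℚₚ.+-identityˡ p)
    (solve 2 (λ p q → (q :- p) :+ p := q) refl p q) (ℚₚ.+-monoˡ-≤ p h)

  ≤⇒0≤ : ∀ {p q} → p ≤ q → 0ℚ ≤ q - p
  ≤⇒0≤ {p} {q} h = subst (_≤ (q - p)) (ℚₚ.+-inverseʳ p) (ℚₚ.+-monoˡ-≤ (- p) h)

  *-pos : ∀ {p q} → 0ℚ < p → 0ℚ < q → 0ℚ < p * q
  *-pos {p} {q} a b = subst (_< p * q) (ℚₚ.*-zeroʳ p)
    (ℚₚ.*-monoʳ-<-pos p {{positive a}} b)

  *-nonneg : ∀ {p q} → 0ℚ ≤ p → 0ℚ ≤ q → 0ℚ ≤ p * q
  *-nonneg {p} {q} a b = subst (_≤ p * q) (ℚₚ.*-zeroʳ p)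
    (ℚₚ.*-monoˡ-≤-nonNeg p {{nonNegative a}} b)

  +-pos : ∀ {p q} → 0ℚ < p → 0ℚ < q → 0ℚ < p + q
  +-pos = ℚₚ.+-mono-<

  0<1 : 0ℚ < 1ℚ
  0<1 = *<* (ℤ.+<+ (ℕ.s≤s ℕ.z≤n))

  0<½ : 0ℚ < ½
  0<½ = *<* (ℤ.+<+ (ℕ.s≤s ℕ.z≤n))

  q<q+1 : ∀ q → q < q + 1ℚ
  q<q+1 q = 0<⇒< (subst (0ℚ <_) (solve 1 (λ q → con 1ℚ := (q :+ con 1ℚ) :- q) refl q) 0<1)

  q-1<q : ∀ q → q - 1ℚ < q
  q-1<q q = 0<⇒< (subst (0ℚ <_) (solve 1 (λ q → con 1ℚ := q :- (q :- con 1ℚ)) refl q) 0<1)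

  square-< : ∀ {p q} → 0ℚ ≤ p → p < q → p * p < q * q
  square-< {p} {q} 0≤p p<q = 0<⇒< (subst (0ℚ <_)
    (solve 2 (λ p q → (q :- p) :* (q :+ p) := q :* q :- p :* p) refl p q)
    (*-pos (<⇒0< p<q) (ℚₚ.+-mono-<-≤ (ℚₚ.≤-<-trans 0≤p p<q) 0≤p)))

  ⊓-pos : ∀ {p q} → 0ℚ < p → 0ℚ < q → 0ℚ < p ⊓ q
  ⊓-pos {p} {q} a b with ℚₚ.⊓-sel p q
  ... | inj₁ e = subst (0ℚ <_) (sym e) a
  ... | inj₂ e = subst (0ℚ <_) (sym e) b

  ⊔-< : ∀ {p q r} → p < r → q < r → p ⊔ q < r
  ⊔-< {p} {q} {r} a b with ℚₚ.⊔-sel p q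
  ... | inj₁ e = subst (_< r) (sym e) a
  ... | inj₂ e = subst (_< r) (sym e) b

  _*ℕ_ : ℕ → ℚ → ℚ
  zero  *ℕ q = 0ℚ
  suc n *ℕ q = q + n *ℕ q

  1/ₚ : ∀ {q} → 0ℚ < q → ∃[ r ] (0ℚ < r × r * q ≡ 1ℚ)
  1/ₚ {q} 0<q = r , ℚₚ.positive⁻¹ r {{ℚₚ.1/pos⇒pos q {{positive 0<q}}}} , ℚₚ.*-inverseˡ q {{nz}}
    where
    nz = ℚₚ.pos⇒nonZero q {{positive 0<q}}
    r  = (1/ q) {{nz}}

fromℚ : ℚ → ℝ
fromℚ q = record
  { L           = _< q
  ; U           = q <_
  ; L-inhabited = q - 1ℚ , q-1<q q
  ; U-inhabited = q + 1ℚ , q<q+1 q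
  ; L-lower     = ℚₚ.<-trans
  ; U-upper     = λ p<r q<p → ℚₚ.<-trans q<p p<r
  ; L-open      = λ p<q → let m , a , b = ℚₚ.<-dense p<q in m , a , b
  ; U-open      = λ q<p → let m , a , b = ℚₚ.<-dense q<p in m , b , a
  ; disjoint    = ℚₚ.<-asym
  ; located     = loc
  }
  where
  loc : ∀ {p r} → p < r → p < q ⊎ q < r
  loc {p} {r} p<r with p ℚₚ.<? q
  ... | yes p<q = inj₁ p<q
  ... | no  p≮q = inj₂ (ℚₚ.≤-<-trans (ℚₚ.≮⇒≥ p≮q) p<r)

0ℝ : ℝ
0ℝ = fromℚ 0ℚ

private
  ≤-numerator : ∀ q → ∃[ n ] (q ≤ n *ℕ 1ℚ)
  ≤-numerator q@(mkℚ n d-1 _) = ℤ.∣ n ∣ , subst (q ≤_) (/1 ℤ.∣ n ∣) (ℚₚ.toℚᵘ-cancel-≤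
      (ℚᵘₚ.≤-respʳ-≃ (ℚᵘₚ.≃-sym (ℚₚ.toℚᵘ-fromℚᵘ (ℚᵘ.mkℚᵘ (+ ℤ.∣ n ∣) 0)))
        (ℚᵘ.*≤* (bound n))))
    where
    import Data.Rational.Unnormalised as ℚᵘ
    import Data.Rational.Unnormalised.Properties as ℚᵘₚ
    bound : ∀ i → i ℤ.* + 1 ℤ.≤ + ℤ.∣ i ∣ ℤ.* + suc d-1
    bound (+ k) = ℤₚ.*-monoˡ-≤-nonNeg (+ k) (ℤ.+≤+ (ℕ.s≤s ℕ.z≤n))
    bound ℤ.-[1+ k ] = ℤ.-≤+
    /1 : ∀ k → + k / 1 ≡ k *ℕ 1ℚ
    /1 zero = refl
    /1 (suc k) = trans (ℚₚ.toℚᵘ-injective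
        (ℚᵘₚ.≃-trans (ℚₚ.toℚᵘ-fromℚᵘ (ℚᵘ.mkℚᵘ (+ suc k) 0))
        (ℚᵘₚ.≃-trans (ℚᵘ.*≡* (eq k))
        (ℚᵘₚ.≃-trans (ℚᵘₚ.+-congʳ ℚᵘ.1ℚᵘ (ℚᵘₚ.≃-sym (ℚₚ.toℚᵘ-fromℚᵘ (ℚᵘ.mkℚᵘ (+ k) 0))))
                     (ℚᵘₚ.≃-sym (ℚₚ.toℚᵘ-homo-+ 1ℚ (+ k / 1)))))))
      (cong (λ z → 1ℚ + z) (/1 k))
      where
      eq : ∀ k → + suc k ℤ.* + 1 ≡ (+ 1 ℤ.* + 1 ℤ.+ + k ℤ.* + 1) ℤ.* + 1
      eq k = cong (ℤ._* + 1) (cong (λ z → + 1 ℤ.+ z) (sym (ℤₚ.*-identityʳ (+ k))))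

  *ℕ-* : ∀ n q → n *ℕ 1ℚ * q ≡ n *ℕ q
  *ℕ-* zero    q = ℚₚ.*-zeroˡ q
  *ℕ-* (suc n) q = trans (ℚₚ.*-distribʳ-+ q 1ℚ (n *ℕ 1ℚ))
    (trans (cong (λ z → z + n *ℕ 1ℚ * q) (ℚₚ.*-identityˡ q)) (cong (λ z → q + z) (*ℕ-* n q)))

  archimedean : ∀ q {δ} → 0ℚ < δ → ∃[ n ] (q ≤ n *ℕ δ)
  archimedean q {δ} 0<δ =
    let r , _ , rδ≡1 = 1/ₚ 0<δ
        n , h        = ≤-numerator (q * r)
    in n , subst₂ _≤_
         (trans (ℚₚ.*-assoc q r δ) (trans (cong (q *_) rδ≡1) (ℚₚ.*-identityʳ q)))
         (*ℕ-* n δ)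
         (ℚₚ.*-monoʳ-≤-nonNeg δ {{nonNegative (ℚₚ.<⇒≤ 0<δ)}} h)

  module _ (x : ℝ) {δ} (0<δ : 0ℚ < δ) where

    approx-from : ∀ n {a} → L x a → U x (a + n *ℕ δ) → ∃[ s ] (L x s × U x (s + (δ + δ)))
    approx-from zero {a} la ua = ⊥-elim (disjoint x la (subst (U x) (ℚₚ.+-identityʳ a) ua))
    approx-from (suc n) {a} la ua =
      [ (λ l → approx-from n l (subst (U x) (sym (ℚₚ.+-assoc a δ (n *ℕ δ))) ua))
      , (λ u → a , la , u)
      ]′ (located x a+δ<a+2δ)
      where
      a+δ<a+2δ : a + δ < a + (δ + δ)
      a+δ<a+2δ = 0<⇒< (subst (0ℚ <_)
        (solve 2 (λ a d → d := (a :+ (d :+ d)) :- (a :+ d)) refl a δ) 0<δ)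

  approx : ∀ x {ε} → 0ℚ < ε → ∃[ s ] ∃[ t ] (L x s × U x t × t - s < ε)
  approx x {ε} 0<ε =
    let a , la   = L-inhabited x
        b , ub   = U-inhabited x
        n , b-a≤ = archimedean (b - a) 0<δ
        b≤       = subst₂ _≤_ (solve 2 (λ a b → a :+ (b :- a) := b) refl a b) refl
                     (ℚₚ.+-monoʳ-≤ a b-a≤)
        s , ls , us = approx-from x 0<δ n la (U-≤ b≤ ub)
    in s , s + (δ + δ) , ls , us ,
       0<⇒< (subst (0ℚ <_)
         (solve 2 (λ e s → e :* con ½ := e :- ((s :+ (e :* con ½ :* con ½ :+ e :* con ½ :* con ½)) :- s))
           refl ε s)
         (*-pos 0<ε 0<½))
    where
    δ   = ε * ½ * ½
    0<δ : 0ℚ < δ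
    0<δ = *-pos (*-pos 0<ε 0<½) 0<½
    U-≤ : ∀ {p q} → p ≤ q → U x p → U x q
    U-≤ p≤q up = let p' , p'<p , up' = U-open x up in U-upper x (ℚₚ.<-≤-trans p'<p p≤q) up'

infixl 6 _+ℝ_
_+ℝ_ : ℝ → ℝ → ℝ
x +ℝ y = record
  { L           = λ r → ∃[ p ] ∃[ q ] (L x p × L y q × r ≡ p + q)
  ; U           = λ r → ∃[ p ] ∃[ q ] (U x p × U y q × r ≡ p + q)
  ; L-inhabited = let p , lp = L-inhabited x ; q , lq = L-inhabited y
                  in p + q , p , q , lp , lq , refl
  ; U-inhabited = let p , up = U-inhabited x ; q , uq = U-inhabited y
                  in p + q , p , q , up , uq , refl
  ; L-lower     = λ { {r} r<s (p , q , lp , lq , refl) →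
                    r - q , q , L-lower x (0<⇒< (subst (0ℚ <_) (eq₁ r p q) (<⇒0< r<s))) lp
                    , lq , eq₂ r q }
  ; U-upper     = λ { {_} {r} s<r (p , q , up , uq , refl) →
                    r - q , q , U-upper x (0<⇒< (subst (0ℚ <_) (eq₃ r p q) (<⇒0< s<r))) up
                    , uq , eq₂ r q }
  ; L-open      = λ { (p , q , lp , lq , refl) → let p' , p<p' , lp' = L-open x lp in
                    p' + q , ℚₚ.+-monoˡ-< q p<p' , p' , q , lp' , lq , refl }
  ; U-open      = λ { (p , q , up , uq , refl) → let p' , p'<p , up' = U-open x up in
                    p' + q , ℚₚ.+-monoˡ-< q p'<p , p' , q , up' , uq , refl }
  ; disjoint    = λ { (p , q , lp , lq , refl) (p' , q' , up , uq , e) →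
                    ℚₚ.<⇒≢ (ℚₚ.+-mono-< (L<U x lp up) (L<U y lq uq)) e }
  ; located     = loc
  }
  where
  eq₁ : ∀ r p q → (p + q) - r ≡ p - (r - q)
  eq₁ = solve 3 (λ r p q → (p :+ q) :- r := p :- (r :- q)) refl
  eq₂ : ∀ r q → r ≡ (r - q) + q
  eq₂ = solve 2 (λ r q → r := (r :- q) :+ q) refl
  eq₃ : ∀ r p q → r - (p + q) ≡ (r - q) - p
  eq₃ = solve 3 (λ r p q → r :- (p :+ q) := (r :- q) :- p) refl
  L<U : ∀ z {p q} → L z p → U z q → p < q
  L<U z {p} {q} l u with p ℚₚ.<? q
  ... | yes p<q = p<q
  ... | no  p≮q with ℚₚ.<-cmp q p
  ...   | tri< q<p _ _ = ⊥-elim (disjoint z l (U-upper z q<p u))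
  ...   | tri≈ _ refl _ = ⊥-elim (disjoint z l u)
  ...   | tri> _ _ p<q = p<q
  loc : ∀ {p q} → p < q →
        (∃[ s ] ∃[ t ] (L x s × L y t × p ≡ s + t)) ⊎ (∃[ s ] ∃[ t ] (U x s × U y t × q ≡ s + t))
  loc {p} {q} p<q = from-approx (approx x (<⇒0< p<q))
    where
    split : ∀ r s → r ≡ s + (r - s)
    split = solve 2 (λ r s → r := s :+ (r :- s)) refl
    p-s<q-t : ∀ s t → t - s < q - p → p - s < q - t
    p-s<q-t s t h = 0<⇒< (subst (0ℚ <_)
      (solve 4 (λ p q s t → (q :- p) :- (t :- s) := (q :- t) :- (p :- s)) refl p q s t)
      (<⇒0< h))
    from-approx : (∃[ s ] ∃[ t ] (L x s × U x t × t - s < q - p)) → _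
    from-approx (s , t , ls , ut , h) =
      [ (λ l → inj₁ (s , p - s , ls , l , split p s))
      , (λ u → inj₂ (t , q - t , ut , u , split q t))
      ]′ (located y (p-s<q-t s t h))

sumℝ : List ℝ → ℝ
sumℝ = foldr _+ℝ_ 0ℝ

private
  square-L-open : ∀ {q r} → 0ℚ ≤ r → r * r < q → ∃[ s ] (r < s × s * s < q)
  square-L-open {q} {r} 0≤r r²<q =
    let 0<k         = ℚₚ.+-mono-<-≤ 0<1 (ℚₚ.+-mono-≤ 0≤r 0≤r)
        i , 0<i , e = 1/ₚ 0<k
        d , 0<d , d<⊓ = ℚₚ.<-dense (⊓-pos 0<1 (*-pos (<⇒0< r²<q) 0<i))
        d<1  = ℚₚ.<-≤-trans d<⊓ (ℚₚ.p⊓q≤p 1ℚ ((q - r * r) * i))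
        d<εi = ℚₚ.<-≤-trans d<⊓ (ℚₚ.p⊓q≤q 1ℚ ((q - r * r) * i))
        dk<ε = subst (d * k <_)
                 (trans (ℚₚ.*-assoc (q - r * r) i k)
                   (trans (cong ((q - r * r) *_) e) (ℚₚ.*-identityʳ (q - r * r))))
                 (ℚₚ.*-monoˡ-<-pos k {{positive 0<k}} d<εi)
    in r + d
     , 0<⇒< (subst (0ℚ <_) (solve 2 (λ r d → d := (r :+ d) :- r) refl r d) 0<d)
     , 0<⇒< (subst (0ℚ <_)
         (solve 3 (λ q r d →
           ((q :- r :* r) :- d :* (con 1ℚ :+ (r :+ r))) :+ d :* (con 1ℚ :- d)
             := q :- (r :+ d) :* (r :+ d)) refl q r d)
         (+-pos (<⇒0< dk<ε) (*-pos 0<d (<⇒0< d<1))))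
    where
    k = 1ℚ + (r + r)

  square-U-open : ∀ {q r} → 0ℚ < r → q < r * r → ∃[ s ] (s < r × 0ℚ < s × q < s * s)
  square-U-open {q} {r} 0<r q<r² =
    let i , 0<i , e = 1/ₚ 0<r
        qir≡q : q * i * r ≡ q
        qir≡q = trans (ℚₚ.*-assoc q i r) (trans (cong (q *_) e) (ℚₚ.*-identityʳ q))
        qi<r  = ℚₚ.*-cancelʳ-<-nonNeg r {{nonNegative (ℚₚ.<⇒≤ 0<r)}} {q * i} {r}
                  (subst (_< r * r) (sym qir≡q) q<r²)
        m     = q * i ⊔ 0ℚ
        m<r   = ⊔-< qi<r 0<r
        q≤mr  = subst (_≤ m * r) qir≡q
                  (ℚₚ.*-monoʳ-≤-nonNeg r {{nonNegative (ℚₚ.<⇒≤ 0<r)}} (ℚₚ.p≤p⊔q (q * i) 0ℚ))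
        0<r-m = *-pos (<⇒0< m<r) 0<½
    in (m + r) * ½
     , 0<⇒< (subst (0ℚ <_)
         (solve 2 (λ m r → (r :- m) :* con ½ := r :- (m :+ r) :* con ½) refl m r) 0<r-m)
     , *-pos (ℚₚ.+-mono-≤-< (ℚₚ.p≤q⊔p (q * i) 0ℚ) 0<r) 0<½
     , ℚₚ.≤-<-trans q≤mr (0<⇒< (subst (0ℚ <_)
         (solve 2 (λ m r → (r :- m) :* con ½ :* ((r :- m) :* con ½)
           := (m :+ r) :* con ½ :* ((m :+ r) :* con ½) :- m :* r) refl m r)
         (*-pos 0<r-m 0<r-m)))

-- For q ≥ 0 these are the cuts of the nonnegative real with square q;
-- for q < 0 they are the cuts of 0.
√_ : ℚ → ℝ
√ q = record
  { L           = λ r → r < 0ℚ ⊎ r * r < q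
  ; U           = λ r → 0ℚ < r × q < r * r
  ; L-inhabited = 0ℚ - 1ℚ , inj₁ (q-1<q 0ℚ)
  ; U-inhabited = c , 0<c , ℚₚ.≤-<-trans (ℚₚ.p≤p⊔q q 0ℚ) m<c²
  ; L-lower     = lower
  ; U-upper     = λ { p<r (0<p , q<p²) →
                    ℚₚ.<-trans 0<p p<r , ℚₚ.<-trans q<p² (square-< (ℚₚ.<⇒≤ 0<p) p<r) }
  ; L-open      = open-L
  ; U-open      = λ { (0<r , q<r²) → square-U-open 0<r q<r² }
  ; disjoint    = λ { (inj₁ r<0) (0<r , _) → ℚₚ.<-asym r<0 0<r
                    ; (inj₂ r²<q) (_ , q<r²) → ℚₚ.<-asym r²<q q<r² }
  ; located     = loc
  }
  where
  m = q ⊔ 0ℚ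
  c = m + 1ℚ
  0≤m : 0ℚ ≤ m
  0≤m = ℚₚ.p≤q⊔p q 0ℚ
  0<c : 0ℚ < c
  0<c = ℚₚ.+-mono-≤-< 0≤m 0<1
  m<c² : m < c * c
  m<c² = 0<⇒< (subst (0ℚ <_)
    (solve 1 (λ m → m :* m :+ m :+ con 1ℚ := (m :+ con 1ℚ) :* (m :+ con 1ℚ) :- m) refl m)
    (ℚₚ.+-mono-≤-< (ℚₚ.+-mono-≤ (*-nonneg 0≤m 0≤m) 0≤m) 0<1))
  lower : ∀ {p r} → p < r → r < 0ℚ ⊎ r * r < q → p < 0ℚ ⊎ p * p < q
  lower p<r (inj₁ r<0) = inj₁ (ℚₚ.<-trans p<r r<0)
  lower {p} p<r (inj₂ r²<q) with p ℚₚ.<? 0ℚ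
  ... | yes p<0 = inj₁ p<0
  ... | no  p≮0 = inj₂ (ℚₚ.<-trans (square-< (ℚₚ.≮⇒≥ p≮0) p<r) r²<q)
  open-L : ∀ {p} → p < 0ℚ ⊎ p * p < q → ∃[ r ] (p < r × (r < 0ℚ ⊎ r * r < q))
  open-L (inj₁ p<0) = let r , p<r , r<0 = ℚₚ.<-dense p<0 in r , p<r , inj₁ r<0
  open-L {p} (inj₂ p²<q) with p ℚₚ.<? 0ℚ
  ... | yes p<0 = let r , p<r , r<0 = ℚₚ.<-dense p<0 in r , p<r , inj₁ r<0
  ... | no  p≮0 = let r , p<r , r²<q = square-L-open (ℚₚ.≮⇒≥ p≮0) p²<q
                  in r , p<r , inj₂ r²<q
  loc : ∀ {p r} → p < r → (p < 0ℚ ⊎ p * p < q) ⊎ (0ℚ < r × q < r * r)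
  loc {p} {r} p<r with p ℚₚ.<? 0ℚ | q ℚₚ.<? r * r
  ... | yes p<0 | _        = inj₁ (inj₁ p<0)
  ... | no  p≮0 | yes q<r² = inj₂ (ℚₚ.≤-<-trans (ℚₚ.≮⇒≥ p≮0) p<r , q<r²)
  ... | no  p≮0 | no  q≮r² = inj₁ (inj₂ (ℚₚ.<-≤-trans (square-< (ℚₚ.≮⇒≥ p≮0) p<r) (ℚₚ.≮⇒≥ q≮r²)))

record Graph (n : ℕ) : Set₁ where
  field
    Adj    : Rel (Fin n) 0ℓ
    adj?   : Decidable Adj
    symm   : Symmetric Adj
    irrefl : Irreflexive _≡_ Adj

open Graph

-- The simple graph generated by a relation: close it symmetrically, drop loops.
fromRel : ∀ {n} {R : Rel (Fin n) 0ℓ} → Decidable R → Graph n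
fromRel {R = R} R? = record
  { Adj    = λ u v → u ≢ v × (R u v ⊎ R v u)
  ; adj?   = λ u v → ¬? (u Fin.≟ v) ×-dec (R? u v ⊎-dec R? v u)
  ; symm   = λ (u≢v , r) → ≢-sym u≢v , swap r
  ; irrefl = λ u≡v (u≢v , _) → u≢v u≡v
  }

Connected : ∀ {n} → Graph n → Set
Connected G = ∀ u v → Star (Adj G) u v

infix 4 _≅_
_≅_ : ∀ {m n} → Graph m → Graph n → Set
_≅_ {m} {n} G H =
  Σ[ f ∈ Fin m ↔ Fin n ] (∀ u v → Adj G u v ⇔ Adj H (Inverse.to f u) (Inverse.to f v))

pathGraph : ∀ n → Graph n
pathGraph n = fromRel {R = λ i j → toℕ j ≡ suc (toℕ i)} (λ i j → toℕ j ℕ.≟ suc (toℕ i))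

-- A cycle only for n ≥ 3; smaller n give the path.
cycleGraph : ∀ n → Graph n
cycleGraph n = fromRel {R = λ i j → toℕ j ≡ suc (toℕ i) ⊎ (suc (toℕ i) ≡ n × toℕ j ≡ 0)}
  (λ i j → (toℕ j ℕ.≟ suc (toℕ i)) ⊎-dec ((suc (toℕ i) ℕ.≟ n) ×-dec (toℕ j ℕ.≟ 0)))

degree : ∀ {n} → Graph n → Fin n → ℕ
degree {n} G u = length (filter (adj? G u) (allFin n))

-- Each edge uv is listed exactly once, as the pair with u < v.
edges : ∀ {n} → Graph n → List (Fin n × Fin n)
edges {n} G = filter (λ (u , v) → (u Finₚ.<? v) ×-dec adj? G u v)
                     (cartesianProduct (allFin n) (allFin n))

ShareEndpoint : ∀ {n} → Rel (Fin n × Fin n) 0ℓ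
ShareEndpoint (a , b) (c , d) = (a ≡ c ⊎ a ≡ d) ⊎ (b ≡ c ⊎ b ≡ d)

shareEndpoint? : ∀ {n} → Decidable (ShareEndpoint {n})
shareEndpoint? (a , b) (c , d) =
  ((a Fin.≟ c) ⊎-dec (a Fin.≟ d)) ⊎-dec ((b Fin.≟ c) ⊎-dec (b Fin.≟ d))

-- Vertex i is the i-th entry of the duplicate-free list of edges, so distinct
-- indices are distinct edges.
lineGraph : ∀ {n} (K : Graph n) → Graph (length (edges K))
lineGraph K = fromRel {R = λ i j → ShareEndpoint (lookup (edges K) i) (lookup (edges K) j)}
  (λ i j → shareEndpoint? (lookup (edges K) i) (lookup (edges K) j))

-- Both denominators below are nonzero for the end-degrees of an edge, so the
-- value at denominator 0 is never used.
ratio : ℕ → ℕ → ℚ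
ratio a zero    = 0ℚ
ratio a (suc b) = + a / suc b

-- Truncated subtraction is harmless: end-degrees of an edge are at least 1.
ABC : ∀ {n} → Graph n → ℝ
ABC G = sumℝ (map (λ (u , v) → √ ratio (d u ℕ.+ d v ℕ.∸ 2) (d u ℕ.* d v)) (edges G))
  where d = degree G

ABS : ∀ {n} → Graph n → ℝ
ABS G = sumℝ (map (λ (u , v) → √ ratio (d u ℕ.+ d v ℕ.∸ 2) (d u ℕ.+ d v)) (edges G))
  where d = degree G

{-# OPTIONS --safe #-}

-- On an edge with end-degrees x and y the ABS term is at least the ABC term unless x or y is 1: in
-- units of 1/300 the difference is at least 20 for {x, y} = {2, ≥ 3}, at least 40 for x, y ≥ 3, and
-- at least −39 for x = 1. The line graph G is connected and claw-free, and it has a vertex of degree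
-- at least 3 because K is neither a path nor a cycle and n ≥ 5. Let every vertex of degree ≥ 3 collect
-- 20 from each incident edge whose other end is not pendant, and let it send 39 along each path of
-- vertices of degree 2 leading away from the vertices of degree ≥ 3, so that the loss at a pendant
-- vertex is paid by the other end of its path. By claw-freeness a vertex of degree ≥ 3 sends along at
-- most one edge, and its other edges, at least two in number, yield at least 40 > 39.
module Submission where

open import Defs
open import Algebra.Properties.Group using (⁻¹-involutive)
open import Data.Bool using (if_then_else_)
open import Data.Fin as Fin using (Fin; zero; suc; toℕ; fromℕ; fromℕ<; inject₁; opposite)
import Data.Fin.Properties as Finₚ
open import Data.Integer as ℤ using (+_)
import Data.Integer.Properties as ℤₚ
open import Data.List as List using (List; []; _∷_; _++_; map; foldr; filter; length; allFin; cartesianProduct)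
import Data.List.Properties as Listₚ
open import Data.List.Membership.Propositional using (_∈_)
import Data.List.Membership.Propositional.Properties as ∈ₚ
open import Data.List.Relation.Unary.All as All using ([]; _∷_)
open import Data.List.Relation.Unary.AllPairs using ([]; _∷_)
open import Data.List.Relation.Unary.Any as Any using (here; there)
import Data.List.Relation.Unary.Any.Properties as Anyₚ
open import Data.List.Relation.Unary.Unique.Propositional using (Unique)
import Data.List.Relation.Unary.Unique.Propositional.Properties as Uniqueₚ
open import Data.Nat as ℕ using (ℕ; zero; suc; _+_; _*_; _∸_; _≤_; _<_; z≤n; s≤s)
open import Data.Nat.Induction using (<-rec)
open import Data.Nat.ListAction using (sum)
import Data.Nat.ListAction.Properties as Sumₚ
import Data.Nat.Properties as ℕₚ
import Data.Nat.Solver as ℕSolver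
open import Data.Product using (_×_; _,_; ∃-syntax; Σ-syntax; proj₁; proj₂)
open import Data.Rational as ℚ using (ℚ; 0ℚ; -_)
import Data.Rational.Properties as ℚₚ
open import Data.Rational.Solver using (module +-*-Solver)
import Data.Rational.Unnormalised as ℚᵘ
import Data.Rational.Unnormalised.Properties as ℚᵘₚ
open import Data.Sum as Sum using (_⊎_; inj₁; inj₂; [_,_]′)
open import Data.Vec as Vec using ([]; _∷_)
open import Function using (_∘_)
open import Function.Bundles using (_⇔_; mk⇔; mk↔ₛ′)
open import Level using (0ℓ)
open import Relation.Binary.Construct.Closure.ReflexiveTransitive using (Star; ε; _◅_; _◅◅_)
open import Relation.Binary.Definitions using (tri<; tri≈; tri>)
open import Relation.Binary.PropositionalEquality
open import Relation.Nullary using (¬_; Dec; yes; no; does; contradiction)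
open import Relation.Nullary.Decidable using (_×-dec_; _⊎-dec_; ¬?; decidable-stable; from-yes)
open import Relation.Unary using (Pred; Decidable)

open ℝ
open Graph

-- Negation and strict comparison of Dedekind cuts

neg-involutive : ∀ q → - (- q) ≡ q
neg-involutive = ⁻¹-involutive ℚₚ.+-0-group

-- Introduced for `bracket`: locatedness of `x +ℝ (-ℝ x)` turns into rational bounds on `x` that are
-- as close as desired.
-ℝ_ : ℝ → ℝ
-ℝ x = record
  { L           = λ q → U x (- q)
  ; U           = λ q → L x (- q)
  ; L-inhabited = let q , u = U-inhabited x in - q , subst (U x) (sym (neg-involutive q)) u
  ; U-inhabited = let q , l = L-inhabited x in - q , subst (L x) (sym (neg-involutive q)) l
  ; L-lower     = λ p<q → U-upper x (ℚₚ.neg-antimono-< p<q)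
  ; U-upper     = λ p<q → L-lower x (ℚₚ.neg-antimono-< p<q)
  ; L-open      = λ {p} u → let q , q<-p , u' = U-open x u in
                    - q , subst (ℚ._< - q) (neg-involutive p) (ℚₚ.neg-antimono-< q<-p)
                    , subst (U x) (sym (neg-involutive q)) u'
  ; U-open      = λ {p} l → let q , -p<q , l' = L-open x l in
                    - q , subst (- q ℚ.<_) (neg-involutive p) (ℚₚ.neg-antimono-< -p<q)
                    , subst (L x) (sym (neg-involutive q)) l'
  ; disjoint    = λ u l → disjoint x l u
  ; located     = λ p<q → Sum.swap (located x (ℚₚ.neg-antimono-< p<q))
  }

-- Locating x + (− x) between − δ and 0 traps x in an interval of length δ.
bracket : ∀ x {δ} → 0ℚ ℚ.< δ → ∃[ s ] ∃[ t ] (L x s × U x t × t ≡ s ℚ.+ δ)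
bracket x {δ} 0<δ = Sum.[ below , above ]′ (located (x +ℝ (-ℝ x)) (ℚₚ.neg-antimono-< 0<δ))
  where
  open ≡-Reasoning
  open +-*-Solver
  neg-t : ∀ {r} s t → r ≡ s ℚ.+ t → - t ≡ s ℚ.- r
  neg-t {r} s t r≡s+t = begin
    - t              ≡⟨ solve 2 (λ s t → :- t := s :- (s :+ t)) refl s t ⟩
    s ℚ.- (s ℚ.+ t)  ≡⟨ cong (λ z → s ℚ.- z) r≡s+t ⟨
    s ℚ.- r          ∎
  below : L (x +ℝ (-ℝ x)) (- δ) → _
  below (s , t , l , u , -δ≡s+t) = s , - t , l , u ,
    trans (neg-t s t -δ≡s+t) (cong (s ℚ.+_) (neg-involutive δ))
  above : U (x +ℝ (-ℝ x)) 0ℚ → _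
  above (s , t , u , l , 0≡s+t) =
    contradiction u (disjoint x (subst (L x) (trans (neg-t s t 0≡s+t) (ℚₚ.+-identityʳ s)) l))

-- The upper end of a bracket of length `γ` around `x` separates the two reals: it is the lower end
-- moved by `γ`, so the shift puts it into the lower cut of `y`.
shift⇒<ℝ : ∀ {x y γ} → 0ℚ ℚ.< γ → (∀ {p} → L x p → L y (p ℚ.+ γ)) → x <ℝ y
shift⇒<ℝ {x} {y} 0<γ shift =
  let s , t , l , u , t≡s+γ = bracket x 0<γ
  in t , u , subst (L y) (sym t≡s+γ) (shift l)

sumℚ : List ℚ → ℚ
sumℚ = foldr ℚ._+_ 0ℚ

-- A lower bound of a sum splits into lower bounds of the terms, so the shifts add up. Since `γ` may
-- take either sign, edges that gain and edges that lose are handled together.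
sumℝ-shift : ∀ {A : Set} {a b : A → ℝ} (γ : A → ℚ) →
             (∀ x {p} → L (a x) p → L (b x) (p ℚ.+ γ x)) →
             ∀ xs {p} → L (sumℝ (map a xs)) p → L (sumℝ (map b xs)) (p ℚ.+ sumℚ (map γ xs))
sumℝ-shift γ shift [] {p} l = subst (ℚ._< 0ℚ) (sym (ℚₚ.+-identityʳ p)) l
sumℝ-shift γ shift (x ∷ xs) (p , q , lp , lq , refl) =
  p ℚ.+ γ x , q ℚ.+ sumℚ (map γ xs) , shift x lp , sumℝ-shift γ shift xs lq ,
  solve 4 (λ p q g s → (p :+ q) :+ (g :+ s) := (p :+ g) :+ (q :+ s)) refl p q (γ x) (sumℚ (map γ xs))
  where open +-*-Solver

-- Charges are counted in units of 1/300, so that the loss √(1/2) − √(1/3) ≈ 0.1298 is at most 39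
-- units and the gain √(3/5) − √(1/2) ≈ 0.0675 at least 20 units, where 39 < 2 · 20.
unit : ℚ
unit = + 1 ℚ./ 300

units : ℕ → ℚ
units zero    = 0ℚ
units (suc k) = unit ℚ.+ units k

units-+ : ∀ m n → units (m ℕ.+ n) ≡ units m ℚ.+ units n
units-+ zero    n = sym (ℚₚ.+-identityˡ (units n))
units-+ (suc m) n = trans (cong (unit ℚ.+_) (units-+ m n)) (sym (ℚₚ.+-assoc unit (units m) (units n)))

0<unit : 0ℚ ℚ.< unit
0<unit = from-yes (0ℚ ℚₚ.<? unit)

units-pos : ∀ k → 0ℚ ℚ.< units (suc k)
units-pos zero    = from-yes (0ℚ ℚₚ.<? units 1)
units-pos (suc k) = ℚₚ.+-mono-< 0<unit (units-pos k)

p-q<p : ∀ p {q} → 0ℚ ℚ.< q → p ℚ.- q ℚ.< p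
p-q<p p {q} 0<q = subst (p ℚ.- q ℚ.<_) (ℚₚ.+-identityʳ p)
  (ℚₚ.+-monoʳ-< p (ℚₚ.neg-antimono-< 0<q))

units-< : ∀ {m n} → m ℕ.< n → 0ℚ ℚ.< units n ℚ.- units m
units-< {m} m<n with k , refl ← ℕₚ.m≤n⇒∃[o]m+o≡n m<n =
  subst (0ℚ ℚ.<_) (begin
    units (suc k)                          ≡⟨ solve 2 (λ m k → k := (m :+ k) :- m) refl (units m) (units (suc k)) ⟩
    units m ℚ.+ units (suc k) ℚ.- units m  ≡⟨ cong (ℚ._- units m) (units-+ m (suc k)) ⟨
    units (m ℕ.+ suc k) ℚ.- units m        ≡⟨ cong (λ n → units n ℚ.- units m) (ℕₚ.+-suc m k) ⟩
    units (suc m ℕ.+ k) ℚ.- units m        ∎)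
  (units-pos k)
  where open ≡-Reasoning
        open +-*-Solver

-- Comparing square roots of rationals

square-mono-≤ : ∀ {p q} → 0ℚ ℚ.≤ p → p ℚ.≤ q → p ℚ.* p ℚ.≤ q ℚ.* q
square-mono-≤ {p} {q} 0≤p p≤q = ℚₚ.≤-trans
  (ℚₚ.*-monoˡ-≤-nonNeg p {{ℚ.nonNegative 0≤p}} p≤q)
  (ℚₚ.*-monoʳ-≤-nonNeg q {{ℚ.nonNegative (ℚₚ.≤-trans 0≤p p≤q)}} p≤q)

square-cancel-< : ∀ {p q} → 0ℚ ℚ.≤ q → p ℚ.* p ℚ.< q ℚ.* q → p ℚ.< q
square-cancel-< 0≤q p²<q² = ℚₚ.≰⇒> λ q≤p → ℚₚ.<-irrefl refl (ℚₚ.<-≤-trans p²<q² (square-mono-≤ 0≤q q≤p))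

√-L<bound : ∀ {A s} → 0ℚ ℚ.< s → A ℚ.≤ s ℚ.* s → ∀ {p} → L (√ A) p → p ℚ.< s
√-L<bound 0<s _ (inj₁ p<0) = ℚₚ.<-trans p<0 0<s
√-L<bound 0<s A≤s² (inj₂ p²<A) = square-cancel-< (ℚₚ.<⇒≤ 0<s) (ℚₚ.<-≤-trans p²<A A≤s²)

-- The rational `s` is a stepping stone: √A ≤ s and s + g < √B, both checked on squares.
√-gain : ∀ {A B} s g → 0ℚ ℚ.< s → A ℚ.≤ s ℚ.* s → (s ℚ.+ g) ℚ.* (s ℚ.+ g) ℚ.< B →
         ∀ {p} → L (√ A) p → L (√ B) (p ℚ.+ g)
√-gain {B = B} s g 0<s A≤s² <B l =
  L-lower (√ B) (ℚₚ.+-monoˡ-< g (√-L<bound 0<s A≤s² l)) (inj₂ <B)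

√-mono : ∀ {A B} → A ℚ.≤ B → ∀ {p} → L (√ A) p → L (√ B) p
√-mono A≤B (inj₁ p<0)  = inj₁ p<0
√-mono A≤B (inj₂ p²<A) = inj₂ (ℚₚ.<-≤-trans p²<A A≤B)

-- With s < √B one has (√B + c)² ≥ B + c(2s + c) ≥ A. In terms of cuts: if t = p - c were not below
-- √B, then t ≥ s and p² = t² + c(2t + c) ≥ A, contrary to p < √A.
√-loss : ∀ {A B} s c → 0ℚ ℚ.≤ c → s ℚ.* s ℚ.< B → A ℚ.≤ B ℚ.+ c ℚ.* (s ℚ.+ s ℚ.+ c) →
         ∀ {p} → L (√ A) p → L (√ B) (p ℚ.- c)
√-loss {A} {B} s c 0≤c s²<B A≤ {p} l with p ℚ.- c ℚₚ.<? 0ℚ | (p ℚ.- c) ℚ.* (p ℚ.- c) ℚₚ.<? B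
... | yes t<0 | _        = inj₁ t<0
... | no  _   | yes t²<B = inj₂ t²<B
... | no  t≮0 | no  t²≮B = contradiction (ℚₚ.<-≤-trans (p²<A l) A≤p²) (ℚₚ.<-irrefl refl)
  where
  open +-*-Solver
  t = p ℚ.- c
  0≤t = ℚₚ.≮⇒≥ t≮0
  B≤t² = ℚₚ.≮⇒≥ t²≮B
  p≡t+c : p ≡ t ℚ.+ c
  p≡t+c = solve 2 (λ p c → p := (p :- c) :+ c) refl p c
  0≤p : 0ℚ ℚ.≤ p
  0≤p = subst (0ℚ ℚ.≤_) (sym p≡t+c) (ℚₚ.+-mono-≤ 0≤t 0≤c)
  p²<A : L (√ A) p → p ℚ.* p ℚ.< A
  p²<A (inj₁ p<0) = contradiction (ℚₚ.<-≤-trans p<0 0≤p) (ℚₚ.<-irrefl refl)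
  p²<A (inj₂ h)   = h
  s≤t : s ℚ.≤ t
  s≤t = ℚₚ.<⇒≤ (square-cancel-< 0≤t (ℚₚ.<-≤-trans s²<B B≤t²))
  A≤p² : A ℚ.≤ p ℚ.* p
  A≤p² = begin
    A                                    ≤⟨ A≤ ⟩
    B ℚ.+ c ℚ.* (s ℚ.+ s ℚ.+ c)          ≤⟨ ℚₚ.+-mono-≤ B≤t² (ℚₚ.*-monoˡ-≤-nonNeg c {{ℚ.nonNegative 0≤c}}
                                              (ℚₚ.+-monoˡ-≤ c (ℚₚ.+-mono-≤ s≤t s≤t))) ⟩
    t ℚ.* t ℚ.+ c ℚ.* (t ℚ.+ t ℚ.+ c)    ≡⟨ solve 2 (λ p c →
                                              (p :- c) :* (p :- c) :+ c :* ((p :- c) :+ (p :- c) :+ c) := p :* p) refl p c ⟩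
    p ℚ.* p                              ∎
    where open ℚₚ.≤-Reasoning

-- The ABC and ABS terms of a single edge

/-mono-≤ : ∀ a b c d → a ℕ.* suc d ℕ.≤ c ℕ.* suc b → + a ℚ./ suc b ℚ.≤ + c ℚ./ suc d
/-mono-≤ a b c d h = ℚₚ.toℚᵘ-cancel-≤ (begin
  ℚ.toℚᵘ (+ a ℚ./ suc b)  ≃⟨ ℚₚ.toℚᵘ-fromℚᵘ (ℚᵘ.mkℚᵘ (+ a) b) ⟩
  ℚᵘ.mkℚᵘ (+ a) b         ≤⟨ ℚᵘ.*≤* (subst₂ ℤ._≤_ (ℤₚ.pos-* a (suc d)) (ℤₚ.pos-* c (suc b)) (ℤ.+≤+ h)) ⟩
  ℚᵘ.mkℚᵘ (+ c) d         ≃⟨ ℚₚ.toℚᵘ-fromℚᵘ (ℚᵘ.mkℚᵘ (+ c) d) ⟨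
  ℚ.toℚᵘ (+ c ℚ./ suc d)  ∎)
  where open ℚᵘₚ.≤-Reasoning

/-+ : ∀ a b c d → + a ℚ./ suc b ℚ.+ + c ℚ./ suc d ≡ + (a ℕ.* suc d ℕ.+ c ℕ.* suc b) ℚ./ (suc b ℕ.* suc d)
/-+ a b c d = ℚₚ.toℚᵘ-injective (begin-equality
  ℚ.toℚᵘ (+ a ℚ./ suc b ℚ.+ + c ℚ./ suc d)
    ≃⟨ ℚₚ.toℚᵘ-homo-+ (+ a ℚ./ suc b) (+ c ℚ./ suc d) ⟩
  ℚ.toℚᵘ (+ a ℚ./ suc b) ℚᵘ.+ ℚ.toℚᵘ (+ c ℚ./ suc d)
    ≃⟨ ℚᵘₚ.+-cong (ℚₚ.toℚᵘ-fromℚᵘ (ℚᵘ.mkℚᵘ (+ a) b)) (ℚₚ.toℚᵘ-fromℚᵘ (ℚᵘ.mkℚᵘ (+ c) d)) ⟩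
  ℚᵘ.mkℚᵘ (+ a) b ℚᵘ.+ ℚᵘ.mkℚᵘ (+ c) d
    ≃⟨ ℚᵘ.*≡* (cong (ℤ._* + (suc b ℕ.* suc d))
         (cong₂ ℤ._+_ (sym (ℤₚ.pos-* a (suc d))) (sym (ℤₚ.pos-* c (suc b))))) ⟩
  ℚᵘ.mkℚᵘ (+ N) D
    ≃⟨ ℚₚ.toℚᵘ-fromℚᵘ (ℚᵘ.mkℚᵘ (+ N) D) ⟨
  ℚ.toℚᵘ (+ N ℚ./ suc D) ∎)
  where open ℚᵘₚ.≤-Reasoning
        N = a ℕ.* suc d ℕ.+ c ℕ.* suc b
        D = d ℕ.+ b ℕ.* suc d

-- An edge joining vertices of degrees x and y contributes halfGain x y to the
-- first endpoint and halfGain y x to the second one, and likewise for halfLoss.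
halfGain : ℕ → ℕ → ℕ
halfGain _                   0             = 0
halfGain _                   1             = 0
halfGain (suc (suc (suc _))) (suc (suc _)) = 20
halfGain _                   _             = 0

halfLoss : ℕ → ℕ
halfLoss 1 = 39
halfLoss _ = 0

gain loss : ℕ → ℕ → ℕ
gain x y = halfGain x y ℕ.+ halfGain y x
loss x y = halfLoss x ℕ.+ halfLoss y

-- Gains and losses stay natural numbers throughout the graph argument; they are combined into a
-- signed rational only here.
net : ℕ × ℕ → ℚ
net (k , l) = units k ℚ.- units l

abc² abs² : ℕ → ℕ → ℚ
abc² x y = ratio (x ℕ.+ y ℕ.∸ 2) (x ℕ.* y)
abs² x y = ratio (x ℕ.+ y ℕ.∸ 2) (x ℕ.+ y)

Shift : ℕ → ℕ → Set
Shift x y = ∀ {p} → L (√ abc² x y) p → L (√ abs² x y) (p ℚ.+ net (gain x y , loss x y))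

shift-sym : ∀ x y → Shift x y → Shift y x
shift-sym x y h {p} rewrite ℕₚ.+-comm y x | ℕₚ.*-comm y x
  | ℕₚ.+-comm (halfGain y x) (halfGain x y) | ℕₚ.+-comm (halfLoss y) (halfLoss x) = h {p}

abs²-nonNeg : ∀ x y → 0ℚ ℚ.≤ abs² x y
abs²-nonNeg x y with x ℕ.+ y
... | zero  = ℚₚ.≤-refl
... | suc b = /-mono-≤ 0 0 (suc b ℕ.∸ 2) b ℕ.z≤n

shift-no-gain : ∀ {A B} k → A ℚ.≤ B → ∀ {p} → L (√ A) p → L (√ B) (p ℚ.+ (units 0 ℚ.- units k))
shift-no-gain {B = B} zero    A≤B {p} l = subst (L (√ B)) (sym (ℚₚ.+-identityʳ p)) (√-mono A≤B l)
shift-no-gain {B = B} (suc k) A≤B {p} l = L-lower (√ B)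
  (subst (λ z → p ℚ.+ z ℚ.< p) (sym (ℚₚ.+-identityˡ (- units (suc k)))) (p-q<p p (units-pos k)))
  (√-mono A≤B l)

≤-by : ∀ {m n} k → m ℕ.+ k ≡ n → m ℕ.≤ n
≤-by {m} k refl = ℕₚ.m≤m+n m k

-- The bound abc² ≤ abs² + 1/6 is (y − 1)/y ≤ (y − 1)/(y + 1) + 1/6, that is (y − 2)(y − 3) ≥ 0.
shift-1 : ∀ y → Shift 1 (suc (suc y))
shift-1 y = √-loss s c (from-yes (0ℚ ℚₚ.≤? c)) (ℚₚ.<-≤-trans (from-yes (s ℚ.* s ℚₚ.<? + 1 ℚ./ 3)) B≥1/3)
  (ℚₚ.≤-trans A≤B+1/6 (ℚₚ.+-monoʳ-≤ (abs² 1 (suc (suc y)))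
    (from-yes (+ 1 ℚ./ 6 ℚₚ.≤? c ℚ.* (s ℚ.+ s ℚ.+ c)))))
  where
  open ℕSolver.+-*-Solver
  s c : ℚ
  -- `s` lies just below √(1/3), and `c` is 39 units. The margin is narrow: c(2s + c) = 0.16692,
  -- against the required 1/6.
  s = + 577 ℚ./ 1000
  c = + 13 ℚ./ 100
  B≥1/3 : + 1 ℚ./ 3 ℚ.≤ + suc y ℚ./ suc (suc (suc y))
  B≥1/3 = /-mono-≤ 1 2 (suc y) (2 ℕ.+ y) (≤-by (2 ℕ.* y)
    (solve 1 (λ y → con 1 :* (con 3 :+ y) :+ con 2 :* y := (con 1 :+ y) :* con 3) refl y))
  A≤B+1/6 : abc² 1 (suc (suc y)) ℚ.≤ abs² 1 (suc (suc y)) ℚ.+ + 1 ℚ./ 6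
  A≤B+1/6 rewrite ℕₚ.+-identityʳ y = subst (+ suc y ℚ./ suc (suc y) ℚ.≤_) (sym (/-+ (suc y) (suc (suc y)) 1 5))
    (/-mono-≤ (suc y) (suc y) (suc y ℕ.* 6 ℕ.+ 1 ℕ.* (3 ℕ.+ y)) (5 ℕ.+ (2 ℕ.+ y) ℕ.* 6)
      -- After cross-multiplication the sides differ by y² - y, where `y` is the degree minus 2;
      -- adding `y` to both sides avoids subtraction.
      (ℕₚ.+-cancelʳ-≤ y _ _ (begin
      suc y ℕ.* ((3 ℕ.+ y) ℕ.* 6) ℕ.+ y
        ≤⟨ ℕₚ.+-monoʳ-≤ (suc y ℕ.* ((3 ℕ.+ y) ℕ.* 6)) (y≤y² y) ⟩
      suc y ℕ.* ((3 ℕ.+ y) ℕ.* 6) ℕ.+ y ℕ.* y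
        ≡⟨ solve 1 (λ y → (con 1 :+ y) :* ((con 3 :+ y) :* con 6) :+ y :* y
             := ((con 1 :+ y) :* con 6 :+ con 1 :* (con 3 :+ y)) :* (con 2 :+ y) :+ y) refl y ⟩
      (suc y ℕ.* 6 ℕ.+ 1 ℕ.* (3 ℕ.+ y)) ℕ.* (2 ℕ.+ y) ℕ.+ y ∎)))
    where
    open ℕₚ.≤-Reasoning
    y≤y² : ∀ y → y ℕ.≤ y ℕ.* y
    y≤y² zero    = ℕ.z≤n
    y≤y² (suc y) = ℕₚ.m≤m*n (suc y) (suc y)

-- A degree 2 at one end makes `abc²` equal to 1/2 whatever the other degree is, while `abs²` is
-- smallest, namely 3/5, when the other degree is 3.
shift-3-2 : ∀ x → Shift (3 ℕ.+ x) 2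
shift-3-2 x = √-gain s g (from-yes (0ℚ ℚₚ.<? s))
  (ℚₚ.≤-trans (/-mono-≤ (suc (x ℕ.+ 2)) (5 ℕ.+ x ℕ.* 2) 1 1 (≤-by 0
    (solve 1 (λ x → (con 1 :+ (x :+ con 2)) :* con 2 :+ con 0 := con 1 :* ((con 3 :+ x) :* con 2)) refl x)))
    (from-yes (+ 1 ℚ./ 2 ℚₚ.≤? s ℚ.* s)))
  (ℚₚ.<-≤-trans (from-yes ((s ℚ.+ g) ℚ.* (s ℚ.+ g) ℚₚ.<? + 3 ℚ./ 5))
    (/-mono-≤ 3 4 (suc (x ℕ.+ 2)) (2 ℕ.+ x ℕ.+ 2) (≤-by (2 ℕ.* x)
    (solve 1 (λ x → con 3 :* (con 3 :+ x :+ con 2) :+ con 2 :* x := (con 1 :+ (x :+ con 2)) :* con 5) refl x))))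
  where
  open ℕSolver.+-*-Solver
  s g : ℚ
  -- 29/41 slightly exceeds √(1/2), since 2 · 29² = 41² + 1; `g` is 20 units.
  s = + 29 ℚ./ 41
  g = + 1 ℚ./ 15

-- Both bounds are attained at degrees 3 and 3: `abc²` is at most 4/9, with root 2/3, and `abs²` is
-- at least 2/3. The gain 2/15 is 40 units, 20 for each end, and (2/3 + 2/15)² = 0.64.
shift-3-3 : ∀ x y → Shift (3 ℕ.+ x) (3 ℕ.+ y)
shift-3-3 x y = √-gain s g (from-yes (0ℚ ℚₚ.<? s))
  (ℚₚ.≤-trans (/-mono-≤ (suc (x ℕ.+ (3 ℕ.+ y))) ((2 ℕ.+ y) ℕ.+ (2 ℕ.+ x) ℕ.* (3 ℕ.+ y)) 4 8
    (≤-by (3 ℕ.* x ℕ.+ 3 ℕ.* y ℕ.+ 4 ℕ.* (x ℕ.* y))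
    (solve 2 (λ x y → (con 1 :+ (x :+ (con 3 :+ y))) :* con 9 :+ (con 3 :* x :+ con 3 :* y :+ con 4 :* (x :* y))
                        := con 4 :* ((con 3 :+ x) :* (con 3 :+ y))) refl x y)))
    (from-yes (+ 4 ℚ./ 9 ℚₚ.≤? s ℚ.* s)))
  (ℚₚ.<-≤-trans (from-yes ((s ℚ.+ g) ℚ.* (s ℚ.+ g) ℚₚ.<? + 2 ℚ./ 3))
    (/-mono-≤ 2 2 (suc (x ℕ.+ (3 ℕ.+ y))) (2 ℕ.+ x ℕ.+ (3 ℕ.+ y)) (≤-by (x ℕ.+ y)
    (solve 2 (λ x y → con 2 :* (con 3 :+ x :+ (con 3 :+ y)) :+ (x :+ y)
                        := (con 1 :+ (x :+ (con 3 :+ y))) :* con 3) refl x y))))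
  where
  open ℕSolver.+-*-Solver
  s g : ℚ
  s = + 2 ℚ./ 3
  g = + 2 ℚ./ 15

-- Degree 0 does not occur at an end of an edge. These cases make `shift` total, so that no
-- positivity of degrees has to be carried; `abc²` takes the default value 0 of `ratio` here.
shift-0 : ∀ y → Shift 0 y
shift-0 0               = shift-no-gain 0 (abs²-nonNeg 0 0)
shift-0 1               = shift-no-gain 39 (abs²-nonNeg 0 1)
shift-0 y@(suc (suc _)) = shift-no-gain 0 (abs²-nonNeg 0 y)

shift : ∀ x y → Shift x y
shift 0 y = shift-0 y
shift 1 0 = shift-sym 0 1 (shift-0 1)
shift 1 1 = shift-no-gain 78 (abs²-nonNeg 1 1)
shift 1 (suc (suc y)) = shift-1 y
shift x@(suc (suc _)) 0 = shift-sym 0 x (shift-0 x)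
shift (suc (suc x)) 1 = shift-sym 1 (2 ℕ.+ x) (shift-1 x)
-- Since 2 + 2 = 2 · 2, the two terms coincide, so edges inside a path of vertices of degree 2 are
-- neutral.
shift 2 2 = shift-no-gain 0 ℚₚ.≤-refl
shift 2 (suc (suc (suc y))) = shift-sym (3 ℕ.+ y) 2 (shift-3-2 y)
shift (suc (suc (suc x))) 2 = shift-3-2 x
shift (suc (suc (suc x))) (suc (suc (suc y))) = shift-3-3 x y

sumℚ-net : ∀ {A : Set} (f g : A → ℕ) xs →
           sumℚ (map (λ x → net (f x , g x)) xs) ≡ net (sum (map f xs) , sum (map g xs))
sumℚ-net f g []       = refl
sumℚ-net f g (x ∷ xs) = begin
  net (f x , g x) ℚ.+ sumℚ (map (λ x → net (f x , g x)) xs)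
    ≡⟨ cong (net (f x , g x) ℚ.+_) (sumℚ-net f g xs) ⟩
  net (f x , g x) ℚ.+ net (F , G)
    ≡⟨ solve 4 (λ a b c d → (a :- b) :+ (c :- d) := (a :+ c) :- (b :+ d)) refl
         (units (f x)) (units (g x)) (units F) (units G) ⟩
  (units (f x) ℚ.+ units F) ℚ.- (units (g x) ℚ.+ units G)
    ≡⟨ cong₂ ℚ._-_ (units-+ (f x) F) (units-+ (g x) G) ⟨
  net (f x ℕ.+ F , g x ℕ.+ G) ∎
  where
  open ≡-Reasoning
  open +-*-Solver
  F = sum (map f xs)
  G = sum (map g xs)

-- This removes the reals: what remains is a strict inequality between two sums of natural numbers
-- over the edges.
loss<gain⇒ABC<ABS : ∀ {n} (G : Graph n) →
  let edgeSum = λ (φ : ℕ → ℕ → ℕ) → sum (map (λ (u , v) → φ (degree G u) (degree G v)) (edges G)) in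
  edgeSum loss ℕ.< edgeSum gain → ABC G <ℝ ABS G
loss<gain⇒ABC<ABS G loss<gain = shift⇒<ℝ {ABC G} {ABS G} (units-< loss<gain) λ {p} l →
  subst (λ z → L (ABS G) (p ℚ.+ z)) (sumℚ-net _ _ (edges G))
    (sumℝ-shift (λ (u , v) → net (gain (d u) (d v) , loss (d u) (d v)))
                (λ (u , v) → shift (d u) (d v)) (edges G) l)
  where d = degree G

-- Discharging in claw-free graphs

private variable
  A B : Set

∑ : List A → (A → ℕ) → ℕ
∑ xs f = sum (map f xs)

∑-cong : ∀ {f g : A → ℕ} → (∀ x → f x ≡ g x) → ∀ xs → ∑ xs f ≡ ∑ xs g
∑-cong f≗g xs = cong sum (Listₚ.map-cong f≗g xs)

∑-+ : ∀ (f g : A → ℕ) xs → ∑ xs (λ x → f x + g x) ≡ ∑ xs f + ∑ xs g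
∑-+ f g []       = refl
∑-+ f g (x ∷ xs) = trans (cong (λ z → f x + g x + z) (∑-+ f g xs))
  (solve 4 (λ a b c d → a :+ b :+ (c :+ d) := a :+ c :+ (b :+ d)) refl (f x) (g x) (∑ xs f) (∑ xs g))
  where open ℕSolver.+-*-Solver

∑-* : ∀ k (f : A → ℕ) xs → ∑ xs (λ x → k * f x) ≡ k * ∑ xs f
∑-* k f []       = sym (ℕₚ.*-zeroʳ k)
∑-* k f (x ∷ xs) = trans (cong (λ z → k * f x + z) (∑-* k f xs)) (sym (ℕₚ.*-distribˡ-+ k (f x) (∑ xs f)))

∑-const : ∀ k (xs : List A) → ∑ xs (λ _ → k) ≡ length xs * k
∑-const k []       = refl
∑-const k (x ∷ xs) = cong (λ z → k + z) (∑-const k xs)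

∑-swap : ∀ (f : A → B → ℕ) xs ys → ∑ xs (λ x → ∑ ys (f x)) ≡ ∑ ys (λ y → ∑ xs (λ x → f x y))
∑-swap f []       ys = sym (trans (∑-const 0 ys) (ℕₚ.*-zeroʳ (length ys)))
∑-swap f (x ∷ xs) ys = trans (cong (λ z → ∑ ys (f x) + z) (∑-swap f xs ys)) (sym (∑-+ (f x) _ ys))

∑-mono-≤ : ∀ {f g : A → ℕ} xs → (∀ {x} → x ∈ xs → f x ≤ g x) → ∑ xs f ≤ ∑ xs g
∑-mono-≤ []       f≤g = z≤n
∑-mono-≤ (x ∷ xs) f≤g = ℕₚ.+-mono-≤ (f≤g (here refl)) (∑-mono-≤ xs (f≤g ∘ there))

∑-mono-< : ∀ {f g : A → ℕ} {xs x} → (∀ x → f x ≤ g x) → x ∈ xs → f x < g x → ∑ xs f < ∑ xs g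
∑-mono-< {xs = _ ∷ xs} f≤g (here refl) fx<gx = ℕₚ.+-mono-<-≤ fx<gx (∑-mono-≤ xs (λ {x} _ → f≤g x))
∑-mono-<               f≤g (there x∈)  fx<gx = ℕₚ.+-mono-≤-< (f≤g _) (∑-mono-< f≤g x∈ fx<gx)

∑-cartesianProduct : ∀ (f : A × B → ℕ) xs ys →
                     ∑ (cartesianProduct xs ys) f ≡ ∑ xs (λ x → ∑ ys (λ y → f (x , y)))
∑-cartesianProduct f []       ys = refl
∑-cartesianProduct f (x ∷ xs) ys = begin
  sum (map f (map (x ,_) ys ++ cartesianProduct xs ys))
    ≡⟨ cong sum (Listₚ.map-++ f (map (x ,_) ys) (cartesianProduct xs ys)) ⟩
  sum (map f (map (x ,_) ys) ++ map f (cartesianProduct xs ys))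
    ≡⟨ Sumₚ.sum-++ (map f (map (x ,_) ys)) _ ⟩
  sum (map f (map (x ,_) ys)) + ∑ (cartesianProduct xs ys) f
    ≡⟨ cong₂ _+_ (cong sum (sym (Listₚ.map-∘ ys))) (∑-cartesianProduct f xs ys) ⟩
  ∑ ys (λ y → f (x , y)) + ∑ xs (λ x → ∑ ys (λ y → f (x , y))) ∎
  where open ≡-Reasoning

𝟙 : ∀ {P : Set} → Dec P → ℕ
𝟙 P? = if does P? then 1 else 0

𝟙-yes : ∀ {P : Set} (P? : Dec P) → P → 𝟙 P? ≡ 1
𝟙-yes (yes _) _ = refl
𝟙-yes (no ¬p) p = contradiction p ¬p

𝟙-no : ∀ {P : Set} (P? : Dec P) → ¬ P → 𝟙 P? ≡ 0
𝟙-no (yes p) ¬p = contradiction p ¬p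
𝟙-no (no _)  _  = refl

∑-filter : ∀ {P : Pred A 0ℓ} (P? : Decidable P) f xs →
           ∑ (filter P? xs) f ≡ ∑ xs (λ x → 𝟙 (P? x) * f x)
∑-filter P? f []       = refl
∑-filter P? f (x ∷ xs) with P? x
... | yes _ = cong₂ _+_ (sym (ℕₚ.*-identityˡ (f x))) (∑-filter P? f xs)
... | no  _ = ∑-filter P? f xs

∑-𝟙≤1 : ∀ {P : Pred A 0ℓ} (P? : Decidable P) {xs} → Unique xs →
        (∀ {x y} → x ∈ xs → y ∈ xs → P x → P y → x ≡ y) → ∑ xs (𝟙 ∘ P?) ≤ 1
∑-𝟙≤1 P? []               P-unique = z≤n
∑-𝟙≤1 {P = P} P? {x ∷ xs} (x∉xs ∷ xs!) P-unique with P? x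
... | no  _  = ∑-𝟙≤1 P? xs! (λ y∈ z∈ → P-unique (there y∈) (there z∈))
... | yes px = s≤s (ℕₚ.≤-trans (∑-mono-≤ xs ¬P) (ℕₚ.≤-reflexive (trans (∑-const 0 xs) (ℕₚ.*-zeroʳ (length xs)))))
  where
  ¬P : ∀ {y} → y ∈ xs → 𝟙 (P? y) ≤ 0
  ¬P {y} y∈ with P? y
  ... | no  _  = z≤n
  ... | yes py = contradiction (P-unique (here refl) (there y∈) px py) (All.lookup x∉xs y∈)

2≤length : ∀ {xs : List A} {x y} → x ∈ xs → y ∈ xs → x ≢ y → 2 ≤ length xs
2≤length (here refl) (here refl) x≢y = contradiction refl x≢y
2≤length (here refl) (there y∈)  x≢y = s≤s (∈ₚ.∈-length y∈)
2≤length (there x∈)  _           x≢y = s≤s (∈ₚ.∈-length x∈)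

3≤length : ∀ {xs : List A} {x y z} → x ∈ xs → y ∈ xs → z ∈ xs → x ≢ y → x ≢ z → y ≢ z → 3 ≤ length xs
3≤length (here refl) (here refl) _           x≢y x≢z y≢z = contradiction refl x≢y
3≤length (here refl) (there _)   (here refl) x≢y x≢z y≢z = contradiction refl x≢z
3≤length (here refl) (there y∈)  (there z∈)  x≢y x≢z y≢z = s≤s (2≤length y∈ z∈ y≢z)
3≤length (there x∈)  (there y∈)  _           x≢y x≢z y≢z = s≤s (2≤length x∈ y∈ x≢y)
3≤length (there x∈)  (here refl) (there z∈)  x≢y x≢z y≢z = s≤s (2≤length x∈ z∈ x≢z)
3≤length (there x∈)  (here refl) (here refl) x≢y x≢z y≢z = contradiction refl y≢z

-- Supplies the third leg when two neighbours of a vertex of degree at least 3 are to be completed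
-- to a claw.
third : ∀ {n} {xs : List (Fin n)} → Unique xs → 3 ≤ length xs →
        ∀ v w → ∃[ z ] (z ∈ xs × z ≢ v × z ≢ w)
third {xs = a ∷ b ∷ c ∷ _} ((a≢b ∷ a≢c ∷ _) ∷ (b≢c ∷ _) ∷ _) _ v w
  with a Fin.≟ v | a Fin.≟ w | b Fin.≟ v | b Fin.≟ w
... | no a≢v   | no a≢w   | _        | _        = a , here refl , a≢v , a≢w
... | _        | _        | no b≢v   | no b≢w   = b , there (here refl) , b≢v , b≢w
... | yes refl | _        | _        | yes refl = c , there (there (here refl)) , a≢c ∘ sym , b≢c ∘ sym
... | _        | yes refl | yes refl | _        = c , there (there (here refl)) , b≢c ∘ sym , a≢c ∘ sym
... | yes refl | _        | yes refl | _        = contradiction refl a≢b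
... | _        | yes refl | _        | yes refl = contradiction refl a≢b
third {xs = []} _ ()
third {xs = _ ∷ []} _ (s≤s ())
third {xs = _ ∷ _ ∷ []} _ (s≤s (s≤s ()))

least : ∀ {P : Pred ℕ 0ℓ} → Decidable P → ∀ k → P k → ∃[ j ] (P j × (∀ {i} → P i → j ≤ i))
least {P} P? = <-rec _ search
  where
  search : ∀ k → (∀ {j} → j < k → P j → _) → P k → _
  search k rec pk with ℕₚ.anyUpTo? P? k
  ... | yes (j , j<k , pj) = rec j<k pj
  ... | no  none           = k , pk , λ {i} pi → ℕₚ.≮⇒≥ (λ i<k → none (i , i<k , pi))

-- Sums over vertices, arcs and edges

module _ {n} (G : Graph n) where

  neighbours : Fin n → List (Fin n)
  neighbours u = filter (adj? G u) (allFin n)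

  ∈-neighbours⁺ : ∀ {u v} → Adj G u v → v ∈ neighbours u
  ∈-neighbours⁺ {u} {v} = ∈ₚ.∈-filter⁺ (adj? G u) (∈ₚ.∈-allFin v)

  ∈-neighbours⁻ : ∀ {u v} → v ∈ neighbours u → Adj G u v
  ∈-neighbours⁻ {u} = proj₂ ∘ ∈ₚ.∈-filter⁻ (adj? G u) {xs = allFin n}

  neighbours-! : ∀ u → Unique (neighbours u)
  neighbours-! u = Uniqueₚ.filter⁺ (adj? G u) (Uniqueₚ.allFin⁺ n)

  3≤degree : ∀ {u x y z} → Adj G u x → Adj G u y → Adj G u z → x ≢ y → x ≢ z → y ≢ z → 3 ≤ degree G u
  3≤degree ux uy uz = 3≤length (∈-neighbours⁺ ux) (∈-neighbours⁺ uy) (∈-neighbours⁺ uz)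

  ∑∑ : (Fin n → Fin n → ℕ) → ℕ
  ∑∑ φ = ∑ (allFin n) (λ u → ∑ (allFin n) (φ u))

  ∑∑-cong : ∀ {φ ψ} → (∀ u v → φ u v ≡ ψ u v) → ∑∑ φ ≡ ∑∑ ψ
  ∑∑-cong eq = ∑-cong (λ u → ∑-cong (eq u) (allFin n)) (allFin n)

  ∑∑-+ : ∀ φ ψ → ∑∑ (λ u v → φ u v + ψ u v) ≡ ∑∑ φ + ∑∑ ψ
  ∑∑-+ φ ψ = trans (∑-cong (λ u → ∑-+ (φ u) (ψ u) (allFin n)) (allFin n)) (∑-+ _ _ (allFin n))

  ∑-arcs : (Fin n → Fin n → ℕ) → ℕ
  ∑-arcs φ = ∑ (allFin n) (λ u → ∑ (neighbours u) (φ u))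

  ∑-arcs≡∑∑ : ∀ φ → ∑-arcs φ ≡ ∑∑ (λ u v → 𝟙 (adj? G u v) * φ u v)
  ∑-arcs≡∑∑ φ = ∑-cong (λ u → ∑-filter (adj? G u) (φ u) (allFin n)) (allFin n)

  ∑-arcs-+ : ∀ φ ψ → ∑-arcs (λ u v → φ u v + ψ u v) ≡ ∑-arcs φ + ∑-arcs ψ
  ∑-arcs-+ φ ψ = trans (∑-cong (λ u → ∑-+ (φ u) (ψ u) (neighbours u)) (allFin n)) (∑-+ _ _ (allFin n))

  𝟙-adj-sym : ∀ u v → 𝟙 (adj? G u v) ≡ 𝟙 (adj? G v u)
  𝟙-adj-sym u v with adj? G u v
  ... | yes uv = sym (𝟙-yes (adj? G v u) (symm G uv))
  ... | no ¬uv = sym (𝟙-no (adj? G v u) (¬uv ∘ symm G))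

  -- Adjacency is symmetric, so exchanging the order of summation reverses all arcs. Applied to
  -- payments: the total sent equals the total received.
  ∑-arcs-flip : ∀ φ → ∑-arcs φ ≡ ∑-arcs (λ u v → φ v u)
  ∑-arcs-flip φ = begin
    ∑-arcs φ                              ≡⟨ ∑-arcs≡∑∑ φ ⟩
    ∑∑ (λ u v → 𝟙 (adj? G u v) * φ u v)   ≡⟨ ∑-swap _ (allFin n) (allFin n) ⟩
    ∑∑ (λ v u → 𝟙 (adj? G u v) * φ u v)   ≡⟨ ∑∑-cong (λ v u → cong (_* φ u v) (𝟙-adj-sym u v)) ⟩
    ∑∑ (λ v u → 𝟙 (adj? G v u) * φ u v)   ≡⟨ ∑-arcs≡∑∑ _ ⟨
    ∑-arcs (λ v u → φ u v)                ∎
    where open ≡-Reasoning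

  forward? : ∀ u v → Dec (u Fin.< v × Adj G u v)
  forward? u v = (u Finₚ.<? v) ×-dec adj? G u v

  𝟙-forward : ∀ u v → 𝟙 (forward? u v) + 𝟙 (forward? v u) ≡ 𝟙 (adj? G u v)
  𝟙-forward u v = go (adj? G u v) (Finₚ.<-cmp u v)
    where
    go : (d : Dec (Adj G u v)) → _ → 𝟙 (forward? u v) + 𝟙 (forward? v u) ≡ 𝟙 d
    go (no ¬uv) _ = cong₂ _+_ (𝟙-no (forward? u v) (¬uv ∘ proj₂)) (𝟙-no (forward? v u) (¬uv ∘ symm G ∘ proj₂))
    go (yes uv) (tri< u<v _ v≮u) = cong₂ _+_ (𝟙-yes (forward? u v) (u<v , uv)) (𝟙-no (forward? v u) (v≮u ∘ proj₁))
    go (yes uv) (tri≈ _ u≡v _)   = contradiction uv (irrefl G u≡v)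
    go (yes uv) (tri> u≮v _ v<u) =
      cong₂ _+_ (𝟙-no (forward? u v) (u≮v ∘ proj₁)) (𝟙-yes (forward? v u) (v<u , symm G uv))

  -- An edge is listed once, with its smaller end first, and contributes its two arcs. This turns
  -- edge sums into sums of local contributions at the vertices.
  ∑-edges : ∀ φ → ∑ (edges G) (λ (u , v) → φ u v + φ v u) ≡ ∑-arcs φ
  ∑-edges φ = begin
    ∑ (edges G) (λ (u , v) → φ u v + φ v u)
      ≡⟨ ∑-filter _ _ (cartesianProduct (allFin n) (allFin n)) ⟩
    ∑ (cartesianProduct (allFin n) (allFin n)) (λ (u , v) → 𝟙 (forward? u v) * (φ u v + φ v u))
      ≡⟨ ∑-cartesianProduct _ (allFin n) (allFin n) ⟩
    ∑∑ (λ u v → 𝟙 (forward? u v) * (φ u v + φ v u))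
      ≡⟨ ∑∑-cong (λ u v → ℕₚ.*-distribˡ-+ (𝟙 (forward? u v)) (φ u v) (φ v u)) ⟩
    ∑∑ (λ u v → 𝟙 (forward? u v) * φ u v + 𝟙 (forward? u v) * φ v u)
      ≡⟨ ∑∑-+ _ _ ⟩
    ∑∑ (λ u v → 𝟙 (forward? u v) * φ u v) + ∑∑ (λ u v → 𝟙 (forward? u v) * φ v u)
      -- Renaming the ends in the second sum replaces `forward? u v` by `forward? v u`; exactly one
      -- of the two holds on each arc.
      ≡⟨ cong (λ z → ∑∑ (λ u v → 𝟙 (forward? u v) * φ u v) + z) (∑-swap _ (allFin n) (allFin n)) ⟩
    ∑∑ (λ u v → 𝟙 (forward? u v) * φ u v) + ∑∑ (λ u v → 𝟙 (forward? v u) * φ u v)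
      ≡⟨ ∑∑-+ _ _ ⟨
    ∑∑ (λ u v → 𝟙 (forward? u v) * φ u v + 𝟙 (forward? v u) * φ u v)
      ≡⟨ ∑∑-cong (λ u v → trans (sym (ℕₚ.*-distribʳ-+ (φ u v) (𝟙 (forward? u v)) (𝟙 (forward? v u))))
                            (cong (_* φ u v) (𝟙-forward u v))) ⟩
    ∑∑ (λ u v → 𝟙 (adj? G u v) * φ u v)
      ≡⟨ ∑-arcs≡∑∑ φ ⟨
    ∑-arcs φ ∎
    where open ≡-Reasoning

ClawFree : ∀ {n} → Graph n → Set
ClawFree G = ∀ {u x y z} → Adj G u x → Adj G u y → Adj G u z →
             x ≢ y → x ≢ z → y ≢ z → Adj G x y ⊎ Adj G x z ⊎ Adj G y z

-- level is the distance to the set of vertices of degree at least 3.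
record Layering {n} (G : Graph n) : Set where
  field
    level     : Fin n → ℕ
    level-0   : ∀ {u} → level u ≡ 0 → 3 ≤ degree G u
    3≤degree⇒ : ∀ {u} → 3 ≤ degree G u → level u ≡ 0
    descend   : ∀ {u} → level u ≢ 0 → ∃[ v ] (Adj G u v × level v < level u)
    lipschitz : ∀ {u v} → Adj G u v → level v ≤ suc (level u)

layering : ∀ {n} (G : Graph n) → Connected G → ∀ w → 3 ≤ degree G w → Layering G
layering {n} G connected w 3≤dw = record
  { level     = level
  ; level-0   = λ {u} eq → subst (λ k → Within k u) eq (within-level u)
  ; 3≤degree⇒ = λ 3≤du → ℕₚ.n≤0⇒n≡0 (level-least 3≤du)
  ; descend   = descend _ refl
  ; lipschitz = λ {u} {v} uv → level-least {suc (level u)} (inj₂ (u , symm G uv , within-level u))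
  }
  where
  -- Distance at most `k` to a vertex of degree at least 3. It is decidable, and connectedness makes
  -- it hold for some `k`, so the least such `k` can be computed and serves as the level.
  Within : ℕ → Fin n → Set
  Within zero    v = 3 ≤ degree G v
  Within (suc k) v = Within k v ⊎ ∃[ u ] (Adj G v u × Within k u)

  within? : ∀ v → Decidable (λ k → Within k v)
  within? v zero    = 3 ℕₚ.≤? degree G v
  within? v (suc k) = within? v k ⊎-dec Finₚ.any? (λ u → adj? G v u ×-dec within? u k)

  reach : ∀ {v} → Star (Adj G) v w → ∃[ k ] Within k v
  reach ε        = 0 , 3≤dw
  reach (vu ◅ p) = let k , h = reach p in suc k , inj₂ (_ , vu , h)

  minimal : ∀ v → ∃[ k ] (Within k v × (∀ {j} → Within j v → k ≤ j))
  minimal v = let k , h = reach (connected v w) in least (within? v) k h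

  level : Fin n → ℕ
  level v = proj₁ (minimal v)

  within-level : ∀ v → Within (level v) v
  within-level v = proj₁ (proj₂ (minimal v))

  level-least : ∀ {k v} → Within k v → level v ≤ k
  level-least {v = v} = proj₂ (proj₂ (minimal v))

  descend : ∀ {u} k → level u ≡ k → k ≢ 0 → ∃[ v ] (Adj G u v × level v < k)
  descend zero    _  k≢0 = contradiction refl k≢0
  descend {u} (suc k) eq _ with subst (λ k → Within k u) eq (within-level u)
  ... | inj₁ h            = contradiction (subst (_≤ k) eq (level-least h)) ℕₚ.1+n≰n
  ... | inj₂ (v , uv , h) = v , uv , s≤s (level-least h)

halfGain-big : ∀ {x y} → 3 ≤ x → 2 ≤ y → halfGain x y ≡ 20
halfGain-big (s≤s (s≤s (s≤s _))) (s≤s (s≤s _)) = refl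

halfLoss-big : ∀ {x} → 2 ≤ x → halfLoss x ≡ 0
halfLoss-big (s≤s (s≤s _)) = refl

-- Payments and the charge balance at each vertex

module _ {n} (G : Graph n) (claw-free : ClawFree G) (layers : Layering G) where
  open Layering layers

  private
    d : Fin n → ℕ
    d = degree G

  -- The pendant vertices, and the vertices that have to pass a charge on.
  Needy : Fin n → Set
  Needy v = d v ≡ 1 ⊎ ∃[ w ] (Adj G v w × level v < level w)

  needy? : ∀ v → Dec (Needy v)
  needy? v = (d v ℕₚ.≟ 1) ⊎-dec Finₚ.any? (λ w → adj? G v w ×-dec (level v ℕₚ.<? level w))

  Pays : Fin n → Fin n → Set
  Pays u v = level u < level v × Needy v

  pays? : ∀ u v → Dec (Pays u v)
  pays? u v = (level u ℕₚ.<? level v) ×-dec needy? v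

  -- The amount 39 is the loss at one pendant vertex. `Pays` does not mention adjacency because
  -- payments are summed only over arcs.
  payment : Fin n → Fin n → ℕ
  payment u v = 39 * 𝟙 (pays? u v)

  payment-yes : ∀ {u v} → Pays u v → payment u v ≡ 39
  payment-yes p = cong (39 *_) (𝟙-yes (pays? _ _) p)

  payment-no : ∀ {u v} → ¬ Pays u v → payment u v ≡ 0
  payment-no ¬p = cong (39 *_) (𝟙-no (pays? _ _) ¬p)

  income expense : Fin n → Fin n → ℕ
  income  u v = halfGain (d u) (d v) + payment v u
  expense u v = halfLoss (d u) + payment u v

  level≢0⇒d<3 : ∀ {u} → level u ≢ 0 → ¬ 3 ≤ d u
  level≢0⇒d<3 l≢0 3≤d = l≢0 (3≤degree⇒ 3≤d)

  -- A pendant `v` has no neighbour besides `u`. Otherwise `v` has positive level, hence degree at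
  -- most 2, and its two neighbours are already `u` and a vertex `x` of higher level.
  lonely : ∀ {u v w} → level u ≡ 0 → Pays u v → Adj G u v → Adj G u w → ¬ Adj G v w
  lonely {u} {v} {w} lu≡0 (lu<lv , inj₁ dv≡1) uv uw vw =
    contradiction (subst (2 ≤_) dv≡1 (2≤length (∈-neighbours⁺ G (symm G uv)) (∈-neighbours⁺ G vw)
      (λ u≡w → irrefl G u≡w uw))) (λ { (s≤s ()) })
  lonely {u} {v} {w} lu≡0 (lu<lv , inj₂ (x , vx , lv<lx)) uv uw vw =
    level≢0⇒d<3 (λ lv≡0 → ℕₚ.n≮0 (subst (level u <_) lv≡0 lu<lv))
      (3≤degree G (symm G uv) vw vx (λ u≡w → irrefl G u≡w uw)
        (λ { refl → ℕₚ.<-asym lu<lv lv<lx })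
        -- `w` differs from `x`: as a neighbour of `u` it has level at most 1, whereas `x` has level
        -- at least 2.
        (λ { refl → ℕₚ.<⇒≱ (ℕₚ.≤-<-trans lu<lv lv<lx) (lipschitz uw) }))

  -- Two different payees and a third neighbour of `u` would have to contain an adjacent pair by
  -- claw-freeness. Each of the three pairs includes a payee, which `lonely` forbids.
  pays-unique : ∀ {u v w} → level u ≡ 0 → Adj G u v → Adj G u w → Pays u v → Pays u w → v ≡ w
  pays-unique {u} {v} {w} lu≡0 uv uw pv pw with v Fin.≟ w
  ... | yes v≡w = v≡w
  ... | no  v≢w with z , z∈ , z≢v , z≢w ← third (neighbours-! G u) (level-0 lu≡0) v w
                with uz ← ∈-neighbours⁻ G z∈
                with claw-free uv uw uz v≢w (z≢v ∘ sym) (z≢w ∘ sym)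
  ... | inj₁ vw        = contradiction vw (lonely lu≡0 pv uv uw)
  ... | inj₂ (inj₁ vz) = contradiction vz (lonely lu≡0 pv uv uz)
  ... | inj₂ (inj₂ wz) = contradiction wz (lonely lu≡0 pw uw uz)

  -- There is at most one payee, so at most 39 is spent. Every neighbour that is not pendant brings
  -- 20, and a pendant neighbour is a payee, so at least two of the three or more neighbours bring
  -- 20 each.
  balance-big : ∀ {u} → level u ≡ 0 → ∑ (neighbours G u) (expense u) < ∑ (neighbours G u) (income u)
  balance-big {u} lu≡0 = begin-strict
    ∑ xs (expense u)                   ≡⟨ ∑-cong (λ v → cong (_+ payment u v) (halfLoss-big 2≤du)) xs ⟩
    ∑ xs (payment u)                   ≡⟨ ∑-* 39 (λ v → 𝟙 (pays? u v)) xs ⟩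
    39 * ∑ xs (λ v → 𝟙 (pays? u v))    ≤⟨ ℕₚ.*-monoʳ-≤ 39 payees≤1 ⟩
    39                                 <⟨ ℕₚ.≤-refl ⟩
    40                                 ≤⟨ 40≤gain ⟩
    ∑ xs (λ v → halfGain (d u) (d v))  ≤⟨ ∑-mono-≤ xs (λ _ → ℕₚ.m≤m+n _ _) ⟩
    ∑ xs (income u)                    ∎
    where
    open ℕₚ.≤-Reasoning
    xs = neighbours G u
    3≤du = level-0 lu≡0
    2≤du = ℕₚ.≤-trans (s≤s (s≤s z≤n)) 3≤du
    payees≤1 : ∑ xs (λ v → 𝟙 (pays? u v)) ≤ 1
    payees≤1 = ∑-𝟙≤1 (pays? u) (neighbours-! G u)
      (λ v∈ w∈ → pays-unique lu≡0 (∈-neighbours⁻ G v∈) (∈-neighbours⁻ G w∈))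
    -- Crediting 20 for a payee makes every neighbour worth at least 20; the credit, at most 20 in
    -- total, is cancelled in `40≤gain`.
    gain-or-payee : ∀ {v} → v ∈ xs → 20 ≤ halfGain (d u) (d v) + 20 * 𝟙 (pays? u v)
    gain-or-payee {v} v∈ with d v ℕₚ.≟ 1
    ... | yes dv≡1 = begin
      20                                            ≡⟨ cong (20 *_) (𝟙-yes (pays? u v) (lu<lv , inj₁ dv≡1)) ⟨
      20 * 𝟙 (pays? u v)                            ≤⟨ ℕₚ.m≤n+m _ (halfGain (d u) (d v)) ⟩
      halfGain (d u) (d v) + 20 * 𝟙 (pays? u v)     ∎
      where
      lv≢0 : level v ≢ 0
      lv≢0 lv≡0 = contradiction (subst (3 ≤_) dv≡1 (level-0 lv≡0)) λ { (s≤s ()) }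
      lu<lv : level u < level v
      lu<lv = subst (_< level v) (sym lu≡0) (ℕₚ.n≢0⇒n>0 lv≢0)
    ... | no  dv≢1 = begin
      20                                            ≡⟨ halfGain-big 3≤du (ℕₚ.≤∧≢⇒< 0<dv (dv≢1 ∘ sym)) ⟨
      halfGain (d u) (d v)                          ≤⟨ ℕₚ.m≤m+n _ _ ⟩
      halfGain (d u) (d v) + 20 * 𝟙 (pays? u v)     ∎
      where
      0<dv : 0 < d v
      0<dv = ∈ₚ.∈-length (∈-neighbours⁺ G (symm G (∈-neighbours⁻ G v∈)))
    40≤gain : 40 ≤ ∑ xs (λ v → halfGain (d u) (d v))
    40≤gain = ℕₚ.+-cancelʳ-≤ 20 _ _ (begin
      60                                                      ≤⟨ ℕₚ.*-monoˡ-≤ 20 3≤du ⟩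
      length xs * 20                                          ≡⟨ ∑-const 20 xs ⟨
      ∑ xs (λ _ → 20)                                         ≤⟨ ∑-mono-≤ xs gain-or-payee ⟩
      ∑ xs (λ v → halfGain (d u) (d v) + 20 * 𝟙 (pays? u v))  ≡⟨ ∑-+ _ _ xs ⟩
      total + ∑ xs (λ v → 20 * 𝟙 (pays? u v))                 ≡⟨ cong (λ z → total + z) (∑-* 20 _ xs) ⟩
      total + 20 * ∑ xs (λ v → 𝟙 (pays? u v))                 ≤⟨ ℕₚ.+-monoʳ-≤ total (ℕₚ.*-monoʳ-≤ 20 payees≤1) ⟩
      total + 20                                              ∎)
      where total = ∑ xs (λ v → halfGain (d u) (d v))

  -- Such a vertex has degree 1 or 2 and a neighbour `p` of lower level, to which it pays nothing.
  -- If it is pendant, the 39 received from `p` covers its loss. If it has degree 2 and pays its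
  -- other neighbour, that makes it needy, and `p` pays it the same amount.
  balance-small : ∀ {u} → level u ≢ 0 → ∑ (neighbours G u) (expense u) ≤ ∑ (neighbours G u) (income u)
  balance-small {u} lu≢0 with p , up , lp<lu ← descend lu≢0 = go (neighbours G u) refl
    where
    open ℕₚ.≤-Reasoning
    refund : payment u p ≡ 0
    refund = payment-no (λ (lu<lp , _) → ℕₚ.<-asym lp<lu lu<lp)

    pass : ∀ {v} → Adj G u v → Dec (Pays u v) → payment u v ≤ payment p u
    pass _ (no ¬pays) = ℕₚ.≤-trans (ℕₚ.≤-reflexive (payment-no ¬pays)) z≤n
    pass {v} uv (yes pays@(lu<lv , _)) =
      ℕₚ.≤-reflexive (trans (payment-yes pays) (sym (payment-yes (lp<lu , inj₂ (v , uv , lu<lv)))))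

    expenses≤income : d u ≡ 2 → ∀ {v} → v ∈ neighbours G u → expense u p + expense u v ≤ income u p
    expenses≤income du≡2 {v} v∈ = begin
      expense u p + expense u v  ≡⟨ cong₂ _+_ (cong₂ _+_ (cong halfLoss du≡2) refund)
                                             (cong (λ k → halfLoss k + payment u v) du≡2) ⟩
      payment u v                ≤⟨ pass (∈-neighbours⁻ G v∈) (pays? u v) ⟩
      payment p u                ≤⟨ ℕₚ.m≤n+m _ (halfGain (d u) (d p)) ⟩
      income u p                 ∎

    go : ∀ xs → neighbours G u ≡ xs → ∑ xs (expense u) ≤ ∑ xs (income u)
    go xs eq with subst (p ∈_) eq (∈-neighbours⁺ G up)
    go (_ ∷ []) eq | here refl = begin
      halfLoss (d u) + payment u p + 0   ≡⟨ ℕₚ.+-identityʳ _ ⟩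
      halfLoss (d u) + payment u p       ≡⟨ cong₂ _+_ (cong halfLoss du≡1) refund ⟩
      39                                 ≡⟨ payment-yes (lp<lu , inj₁ du≡1) ⟨
      payment p u                        ≤⟨ ℕₚ.m≤n+m _ (halfGain (d u) (d p)) ⟩
      income u p                         ≤⟨ ℕₚ.m≤m+n _ _ ⟩
      income u p + 0                     ∎
      where
      du≡1 : d u ≡ 1
      du≡1 = cong length eq
    go (_ ∷ v ∷ []) eq | here refl = begin
      expense u p + (expense u v + 0)    ≡⟨ cong (λ z → expense u p + z) (ℕₚ.+-identityʳ _) ⟩
      expense u p + expense u v          ≤⟨ expenses≤income (cong length eq)
                                              (subst (v ∈_) (sym eq) (there (here refl))) ⟩
      income u p                         ≤⟨ ℕₚ.m≤m+n _ _ ⟩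
      income u p + (income u v + 0)      ∎
    go (v ∷ _ ∷ []) eq | there (here refl) = begin
      expense u v + (expense u p + 0)    ≡⟨ cong (λ z → expense u v + z) (ℕₚ.+-identityʳ _) ⟩
      expense u v + expense u p          ≡⟨ ℕₚ.+-comm (expense u v) _ ⟩
      expense u p + expense u v          ≤⟨ expenses≤income (cong length eq) (subst (v ∈_) (sym eq) (here refl)) ⟩
      income u p                         ≤⟨ ℕₚ.m≤m+n _ _ ⟩
      income u p + 0                     ≤⟨ ℕₚ.m≤n+m _ (income u v) ⟩
      income u v + (income u p + 0)      ∎
    go (_ ∷ _ ∷ _ ∷ _) eq | _ = contradiction
      (subst (3 ≤_) (sym (cong length eq)) (s≤s (s≤s (s≤s z≤n)))) (level≢0⇒d<3 lu≢0)

  balance : ∀ u → ∑ (neighbours G u) (expense u) ≤ ∑ (neighbours G u) (income u)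
  balance u with level u ℕₚ.≟ 0
  ... | yes lu≡0 = ℕₚ.<⇒≤ (balance-big lu≡0)
  ... | no  lu≢0 = balance-small lu≢0

  -- Summing the balances over all vertices, payments occur once as expense and once as income and
  -- cancel. The vertex `w` makes the inequality strict.
  discharging : ∀ w → 3 ≤ d w → ABC G <ℝ ABS G
  discharging w 3≤dw = loss<gain⇒ABC<ABS G (begin-strict
    ∑ (edges G) (λ (u , v) → loss (d u) (d v))    ≡⟨ ∑-edges G (λ u v → halfLoss (d u)) ⟩
    losses                                        <⟨ ℕₚ.+-cancelʳ-< (∑-arcs G payment) _ _ total ⟩
    gains                                         ≡⟨ ∑-edges G (λ u v → halfGain (d u) (d v)) ⟨
    ∑ (edges G) (λ (u , v) → gain (d u) (d v))    ∎)
    where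
    open ℕₚ.≤-Reasoning
    losses = ∑-arcs G (λ u v → halfLoss (d u))
    gains  = ∑-arcs G (λ u v → halfGain (d u) (d v))
    total : losses + ∑-arcs G payment < gains + ∑-arcs G payment
    total = begin-strict
      losses + ∑-arcs G payment                 ≡⟨ ∑-arcs-+ G _ _ ⟨
      ∑-arcs G expense                          <⟨ ∑-mono-< balance (∈ₚ.∈-allFin w) (balance-big (3≤degree⇒ 3≤dw)) ⟩
      ∑-arcs G income                           ≡⟨ ∑-arcs-+ G _ _ ⟩
      gains + ∑-arcs G (λ u v → payment v u)    ≡⟨ cong (λ z → gains + z) (∑-arcs-flip G payment) ⟨
      gains + ∑-arcs G payment                  ∎

-- Line graphs

section-injective : ∀ {A B : Set} {g : A → B} (surj : ∀ y → ∃[ x ] g x ≡ y) →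
                    ∀ {y z} → proj₁ (surj y) ≡ proj₁ (surj z) → y ≡ z
section-injective {g = g} surj {y} {z} e = trans (sym (proj₂ (surj y))) (trans (cong g e) (proj₂ (surj z)))

uncovered : ∀ {m n} → m < n → (g : Fin m → Fin n) → ∃[ x ] (∀ k → g k ≢ x)
uncovered m<n g with Finₚ.any? (λ x → Finₚ.all? (λ k → ¬? (g k Fin.≟ x)))
... | yes missed = missed
... | no  none   = contradiction (Finₚ.injective⇒≤ (section-injective covered)) (ℕₚ.<⇒≱ m<n)
  where
  covered : ∀ x → ∃[ k ] g k ≡ x
  covered x = decidable-stable (Finₚ.any? (λ k → g k Fin.≟ x))
    (λ ¬cov → none (x , λ k gk≡x → ¬cov (k , gk≡x)))

exit : ∀ {A : Set} {R : A → A → Set} {P : Pred A 0ℓ} → Decidable P → ∀ {x y} → Star R x y →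
       P x → ¬ P y → ∃[ u ] ∃[ v ] (R u v × P u × ¬ P v)
exit P? ε                  px ¬py = contradiction px ¬py
exit P? {x} (_◅_ {j = z} xz zy) px ¬py with P? z
... | yes pz = exit P? zy pz ¬py
... | no ¬pz = x , z , xz , px , ¬pz

module _ {n} (K : Graph n) where

  private
    LK = lineGraph K

    endpoints : Fin (length (edges K)) → Fin n × Fin n
    endpoints = List.lookup (edges K)

  Incident : Fin (length (edges K)) → Fin n → Set
  Incident i a = proj₁ (endpoints i) ≡ a ⊎ proj₂ (endpoints i) ≡ a

  incident⇒adj : ∀ {i j a} → Incident i a → Incident j a → i ≢ j → Adj LK i j
  incident⇒adj (inj₁ refl) (inj₁ e) i≢j = i≢j , inj₁ (inj₁ (inj₁ (sym e)))
  incident⇒adj (inj₁ refl) (inj₂ e) i≢j = i≢j , inj₁ (inj₁ (inj₂ (sym e)))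
  incident⇒adj (inj₂ refl) (inj₁ e) i≢j = i≢j , inj₁ (inj₂ (inj₁ (sym e)))
  incident⇒adj (inj₂ refl) (inj₂ e) i≢j = i≢j , inj₁ (inj₂ (inj₂ (sym e)))

  adj⇒incident : ∀ {i j} → Adj LK i j → Incident j (proj₁ (endpoints i)) ⊎ Incident j (proj₂ (endpoints i))
  adj⇒incident (_ , inj₁ (inj₁ (inj₁ e))) = inj₁ (inj₁ (sym e))
  adj⇒incident (_ , inj₁ (inj₁ (inj₂ e))) = inj₁ (inj₂ (sym e))
  adj⇒incident (_ , inj₁ (inj₂ (inj₁ e))) = inj₂ (inj₁ (sym e))
  adj⇒incident (_ , inj₁ (inj₂ (inj₂ e))) = inj₂ (inj₂ (sym e))
  adj⇒incident (_ , inj₂ (inj₁ (inj₁ e))) = inj₁ (inj₁ e)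
  adj⇒incident (_ , inj₂ (inj₁ (inj₂ e))) = inj₂ (inj₁ e)
  adj⇒incident (_ , inj₂ (inj₂ (inj₁ e))) = inj₁ (inj₂ e)
  adj⇒incident (_ , inj₂ (inj₂ (inj₂ e))) = inj₂ (inj₂ e)

  -- Pigeonhole: of three edges that meet a given edge, two meet it at the same endpoint and are
  -- therefore adjacent.
  lineGraph-clawFree : ClawFree LK
  lineGraph-clawFree ux uy uz x≢y x≢z y≢z with adj⇒incident ux | adj⇒incident uy | adj⇒incident uz
  ... | inj₁ x | inj₁ y | _      = inj₁ (incident⇒adj x y x≢y)
  ... | inj₂ x | inj₂ y | _      = inj₁ (incident⇒adj x y x≢y)
  ... | inj₁ x | inj₂ _ | inj₁ z = inj₂ (inj₁ (incident⇒adj x z x≢z))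
  ... | inj₂ x | inj₁ _ | inj₂ z = inj₂ (inj₁ (incident⇒adj x z x≢z))
  ... | inj₁ _ | inj₂ y | inj₂ z = inj₂ (inj₂ (incident⇒adj y z y≢z))
  ... | inj₂ _ | inj₁ y | inj₁ z = inj₂ (inj₂ (incident⇒adj y z y≢z))

  -- The list of edges stores each pair in increasing order. This description of an index is
  -- symmetric in the two endpoints, so later arguments need not compare them.
  record Edge (a b : Fin n) : Set where
    field
      index     : Fin (length (edges K))
      incident₁ : Incident index a
      incident₂ : Incident index b
      only      : ∀ {x} → Incident index x → x ≡ a ⊎ x ≡ b
  open Edge

  flip : ∀ {a b} → Edge a b → Edge b a
  flip e = record { index = index e ; incident₁ = incident₂ e ; incident₂ = incident₁ e
                  ; only = λ i → [ inj₂ , inj₁ ]′ (only e i) }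

  private
    edge-< : ∀ {a b} → a Fin.< b → Adj K a b → Edge a b
    edge-< {a} {b} a<b ab = record
      { index     = i
      ; incident₁ = inj₁ (cong proj₁ (sym eq))
      ; incident₂ = inj₂ (cong proj₂ (sym eq))
      ; only      = [ (λ e → inj₁ (trans (sym e) (cong proj₁ (sym eq))))
                    , (λ e → inj₂ (trans (sym e) (cong proj₂ (sym eq)))) ]′
      }
      where
      ab∈edges : (a , b) ∈ edges K
      ab∈edges = ∈ₚ.∈-filter⁺ (λ (u , v) → (u Finₚ.<? v) ×-dec adj? K u v)
        (∈ₚ.∈-cartesianProduct⁺ (∈ₚ.∈-allFin a) (∈ₚ.∈-allFin b)) (a<b , ab)
      i = Any.index ab∈edges
      eq : (a , b) ≡ endpoints i
      eq = Anyₚ.lookup-index ab∈edges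

  edge : ∀ {a b} → Adj K a b → Edge a b
  edge {a} {b} ab with Finₚ.<-cmp a b
  ... | tri< a<b _ _ = edge-< a<b ab
  ... | tri≈ _ a≡b _ = contradiction ab (irrefl K a≡b)
  ... | tri> _ _ b<a = flip (edge-< b<a (symm K ab))

  distinct-edges : ∀ {a b c d} (e : Edge a b) (f : Edge c d) → b ≢ c → b ≢ d → index e ≢ index f
  distinct-edges e f b≢c b≢d eq = [ b≢c , b≢d ]′ (only f (subst (λ i → Incident i _) eq (incident₂ e)))

  -- A walk in `K` between endpoints of the two edges is traced by its own edges, consecutive ones
  -- sharing a vertex.
  lineGraph-connected : Connected K → Connected LK
  lineGraph-connected connected i j =
    walk (connected (proj₁ (endpoints i)) (proj₁ (endpoints j))) (inj₁ refl) (inj₁ refl)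
    where
    meet : ∀ {i j a} → Incident i a → Incident j a → Star (Adj LK) i j
    meet {i} {j} p q with i Fin.≟ j
    ... | yes refl = ε
    ... | no  i≢j  = incident⇒adj p q i≢j ◅ ε
    walk : ∀ {i j a c} → Star (Adj K) a c → Incident i a → Incident j c → Star (Adj LK) i j
    walk ε         p q = meet p q
    walk (ax ◅ xc) p q = meet p (incident₁ (edge ax)) ◅◅ walk xc (incident₂ (edge ax)) q

  -- Branching vertices and large degrees in the line graph

  record Branching : Set where
    constructor branching
    field
      {centre leg₁ leg₂ leg₃} : Fin n
      adj₁ : Adj K centre leg₁
      adj₂ : Adj K centre leg₂
      adj₃ : Adj K centre leg₃
      1≢2  : leg₁ ≢ leg₂
      1≢3  : leg₁ ≢ leg₃
      2≢3  : leg₂ ≢ leg₃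

  -- The edge `wa` meets `wb` and `wc` at `w`, and meets `yz` at `y`. The edge `yz` differs from the
  -- other three because `z` lies on none of them.
  3≤degree-edge : ∀ {w a b c y z} → Adj K w a → Adj K w b → Adj K w c → Adj K y z → a ≢ b → a ≢ c → b ≢ c →
                  y ≡ w ⊎ y ≡ a → z ≢ w → z ≢ a → z ≢ b → z ≢ c → ∃[ i ] 3 ≤ degree LK i
  3≤degree-edge {w} {a} {b} {c} {y} {z} wa wb wc yz a≢b a≢c b≢c y∈wa z≢w z≢a z≢b z≢c =
    index e , 3≤degree LK
      (incident⇒adj (incident₁ e) (incident₁ f) (≢-sym (distinct-edges f e (≢w wb) (≢-sym a≢b))))
      (incident⇒adj (incident₁ e) (incident₁ g) (≢-sym (distinct-edges g e (≢w wc) (≢-sym a≢c))))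
      (e~h y∈wa)
      (distinct-edges f g (≢w wb) b≢c)
      (≢-sym (distinct-edges h f z≢w z≢b))
      (≢-sym (distinct-edges h g z≢w z≢c))
    where
    e = edge wa
    f = edge wb
    g = edge wc
    h = edge yz
    ≢w : ∀ {v} → Adj K w v → v ≢ w
    ≢w wv v≡w = irrefl K (sym v≡w) wv
    e≢h : index e ≢ index h
    e≢h = ≢-sym (distinct-edges h e z≢w z≢a)
    e~h : y ≡ w ⊎ y ≡ a → Adj LK (index e) (index h)
    e~h (inj₁ refl) = incident⇒adj (incident₁ e) (incident₁ h) e≢h
    e~h (inj₂ refl) = incident⇒adj (incident₂ e) (incident₁ h) e≢h

  -- A star with three legs has four vertices, so a fifth exists and connectedness yields an edge
  -- `yz` leaving the star. The star alone would not do: its line graph is a triangle.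
  branching⇒3≤degree : 5 ≤ n → Connected K → Branching → ∃[ i ] 3 ≤ degree LK i
  branching⇒3≤degree 5≤n connected (branching {w} {a} {b} {c} wa wb wc a≢b a≢c b≢c)
    with x , x∉ ← uncovered 5≤n (Vec.lookup (w ∷ a ∷ b ∷ c ∷ []))
    with exit (λ v → Finₚ.any? (λ k → Vec.lookup (w ∷ a ∷ b ∷ c ∷ []) k Fin.≟ v)) (connected w x)
           (zero , refl) (λ (k , eq) → x∉ k eq)
  ... | y , z , yz , (k , y≡) , z∉ = go k y≡
    where
    ≢z : ∀ k → z ≢ Vec.lookup (w ∷ a ∷ b ∷ c ∷ []) k
    ≢z k z≡ = z∉ (k , sym z≡)
    z≢w = ≢z zero
    z≢a = ≢z (suc zero)
    z≢b = ≢z (suc (suc zero))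
    z≢c = ≢z (suc (suc (suc zero)))
    -- The legs are permuted so that the first star edge contains `y`; when `y` is the centre, any
    -- leg serves.
    go : ∀ k → Vec.lookup (w ∷ a ∷ b ∷ c ∷ []) k ≡ y → ∃[ i ] 3 ≤ degree LK i
    go zero                   e = 3≤degree-edge wa wb wc yz a≢b a≢c b≢c (inj₁ (sym e)) z≢w z≢a z≢b z≢c
    go (suc zero)             e = 3≤degree-edge wa wb wc yz a≢b a≢c b≢c (inj₂ (sym e)) z≢w z≢a z≢b z≢c
    go (suc (suc zero))       e = 3≤degree-edge wb wa wc yz (≢-sym a≢b) b≢c a≢c (inj₂ (sym e)) z≢w z≢b z≢a z≢c
    go (suc (suc (suc zero))) e = 3≤degree-edge wc wa wb yz (≢-sym a≢c) (≢-sym b≢c) a≢b (inj₂ (sym e)) z≢w z≢c z≢a z≢b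

  branching? : Dec Branching
  branching? with Finₚ.any? (λ w → Finₚ.any? (λ a → Finₚ.any? (λ b → Finₚ.any? (λ c →
    adj? K w a ×-dec adj? K w b ×-dec adj? K w c ×-dec ¬? (a Fin.≟ b) ×-dec ¬? (a Fin.≟ c) ×-dec ¬? (b Fin.≟ c)))))
  ... | yes (_ , _ , _ , _ , wa , wb , wc , a≢b , a≢c , b≢c) = yes (branching wa wb wc a≢b a≢c b≢c)
  ... | no  none = no λ (branching wa wb wc a≢b a≢c b≢c) → none (_ , _ , _ , _ , wa , wb , wc , a≢b , a≢c , b≢c)

  -- Maximal paths in graphs without branching

  record PathIn (m : ℕ) : Set where
    field
      -- The parameter `m` counts edges, and chords between the vertices are allowed.
      vertex    : Fin (suc m) → Fin n
      injective : ∀ {i j} → vertex i ≡ vertex j → i ≡ j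
      step      : ∀ {i j} → toℕ j ≡ suc (toℕ i) → Adj K (vertex i) (vertex j)

    Visited : Fin n → Set
    Visited v = ∃[ i ] vertex i ≡ v

    visited? : ∀ v → Dec (Visited v)
    visited? v = Finₚ.any? (λ i → vertex i Fin.≟ v)
  open PathIn

  singleton : Fin n → PathIn 0
  singleton v = record
    { vertex    = λ _ → v
    ; injective = λ { {zero} {zero} _ → refl }
    ; step      = λ { {zero} {zero} () }
    }

  extend : ∀ {m} (p : PathIn m) {v} → Adj K (vertex p zero) v → ¬ Visited p v → PathIn (suc m)
  extend {m} p {v} 0v new = record { vertex = f ; injective = inj ; step = stp }
    where
    f : Fin (suc (suc m)) → Fin n
    f zero    = v
    f (suc i) = vertex p i
    inj : ∀ {i j} → f i ≡ f j → i ≡ j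
    inj {zero}  {zero}  _ = refl
    inj {zero}  {suc j} e = contradiction (j , sym e) new
    inj {suc i} {zero}  e = contradiction (i , e) new
    inj {suc i} {suc j} e = cong suc (injective p e)
    stp : ∀ {i j} → toℕ j ≡ suc (toℕ i) → Adj K (f i) (f j)
    stp {zero}  {suc zero} _ = symm K 0v
    stp {suc i} {suc j}    e = step p (ℕₚ.suc-injective e)

  -- Lets `extend` and `Stuck`, which speak of the first vertex only, be used at the other end too.
  reverse : ∀ {m} → PathIn m → PathIn m
  reverse {m} p = record
    { vertex    = vertex p ∘ opposite
    ; injective = λ {i} {j} e → trans (sym (Finₚ.opposite-involutive i))
                    (trans (cong opposite (injective p e)) (Finₚ.opposite-involutive j))
    ; step      = λ {i} {j} e → symm K (step p (opposite-step i j e))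
    }
    where
    open ≡-Reasoning
    opposite-step : ∀ (i j : Fin (suc m)) → toℕ j ≡ suc (toℕ i) → toℕ (opposite i) ≡ suc (toℕ (opposite j))
    opposite-step i j e = begin
      toℕ (opposite i)        ≡⟨ Finₚ.opposite-prop i ⟩
      suc m ∸ suc (toℕ i)     ≡⟨ ℕₚ.+-∸-assoc 1 (subst (_≤ m) e (Finₚ.toℕ≤pred[n] j)) ⟩
      suc (m ∸ suc (toℕ i))   ≡⟨ cong (λ k → suc (m ∸ k)) e ⟨
      suc (m ∸ toℕ j)         ≡⟨ cong suc (Finₚ.opposite-prop j) ⟨
      suc (toℕ (opposite j))  ∎

  Stuck : ∀ {m} → PathIn m → Set
  Stuck p = ∀ {v} → Adj K (vertex p zero) v → Visited p v

  stuck-or-extends : ∀ {m} (p : PathIn m) → Stuck p ⊎ PathIn (suc m)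
  stuck-or-extends p with Finₚ.any? (λ v → adj? K (vertex p zero) v ×-dec ¬? (visited? p v))
  ... | yes (v , 0v , new) = inj₂ (extend p 0v new)
  ... | no  none           = inj₁ λ {v} 0v → decidable-stable (visited? p v) λ new → none (v , 0v , new)

  -- `k` is fuel: injectivity bounds the number `suc m` of path vertices by `n`, so the path cannot
  -- have `n` edges, and each extension lowers `k` while raising `m`.
  maximal : ∀ k {m} → n ≤ k + m → PathIn m → ∃[ m′ ] Σ[ p ∈ PathIn m′ ] (Stuck p × Stuck (reverse p))
  maximal zero        n≤m p = contradiction (Finₚ.injective⇒≤ (injective p)) (ℕₚ.<⇒≱ (s≤s n≤m))
  maximal (suc k) {m} n≤  p with stuck-or-extends p | stuck-or-extends (reverse p)
  ... | inj₁ s | inj₁ s′ = m , p , s , s′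
  ... | inj₂ q | _       = maximal k (subst (n ≤_) (sym (ℕₚ.+-suc k m)) n≤) q
  ... | inj₁ _ | inj₂ q  = maximal k (subst (n ≤_) (sym (ℕₚ.+-suc k m)) n≤) q

  module _ (unbranched : ¬ Branching) {m} (p : PathIn m) where

    Consecutive : Fin (suc m) → Fin (suc m) → Set
    Consecutive i j = toℕ j ≡ suc (toℕ i) ⊎ toℕ i ≡ suc (toℕ j)

    -- An inner vertex of the path has its predecessor and its successor as neighbours already; one
    -- more would be a branching.
    neighbour : ∀ i {v} → Adj K (vertex p i) v →
                i ≡ zero ⊎ i ≡ fromℕ m ⊎ ∃[ j ] (vertex p j ≡ v × Consecutive i j)
    neighbour zero _ = inj₁ refl
    neighbour i@(suc i′) {v} iv with toℕ i ℕ.≟ m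
    ... | yes i≡m = inj₂ (inj₁ (Finₚ.toℕ-injective (trans i≡m (sym (Finₚ.toℕ-fromℕ m)))))
    ... | no  i≢m = inj₂ (inj₂ find)
      where
      i<m : suc (toℕ i) < suc m
      i<m = s≤s (ℕₚ.≤∧≢⇒< (Finₚ.toℕ≤pred[n] i) i≢m)
      before after : Fin (suc m)
      before = inject₁ i′
      after  = fromℕ< i<m
      before-step : toℕ i ≡ suc (toℕ before)
      before-step = cong suc (sym (Finₚ.toℕ-inject₁ i′))
      after-step : toℕ after ≡ suc (toℕ i)
      after-step = Finₚ.toℕ-fromℕ< i<m
      before≢after : vertex p before ≢ vertex p after
      before≢after e = ℕₚ.<⇒≢ (ℕₚ.m≤n⇒m≤1+n ℕₚ.≤-refl)
        (trans (cong toℕ (injective p e)) (trans after-step (cong suc before-step)))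
      find : ∃[ j ] (vertex p j ≡ v × Consecutive i j)
      find with vertex p before Fin.≟ v | vertex p after Fin.≟ v
      ... | yes e | _     = before , e , inj₂ before-step
      ... | _     | yes e = after , e , inj₁ after-step
      ... | no  b≢v | no a≢v = contradiction
        (branching (symm K (step p before-step)) (step p after-step) iv before≢after b≢v a≢v) unbranched

    -- The visited set is closed under adjacency, by `neighbour` at inner vertices and by `Stuck` at
    -- both ends, so a walk to an unvisited vertex could never leave it.
    spanning : Connected K → Stuck p → Stuck (reverse p) → ∀ v → Visited p v
    spanning connected s s′ v = decidable-stable (visited? p v) λ new →
      let x , y , xy , seen , unseen = exit (visited? p) (connected (vertex p zero) v) (zero , refl) new
      in unseen (closed seen xy)
      where
      closed : ∀ {x y} → Visited p x → Adj K x y → Visited p y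
      closed (i , refl) xy with neighbour i xy
      ... | inj₁ refl               = s xy
      -- The first vertex of `reverse p` is the one at `fromℕ m`; `opposite` translates the position
      -- found by `s′` back to `p`.
      ... | inj₂ (inj₁ refl)        = let j , e = s′ xy in opposite j , e
      ... | inj₂ (inj₂ (j , e , _)) = j , e

    Ends : Fin (suc m) → Fin (suc m) → Set
    Ends i j = i ≡ fromℕ m × j ≡ zero

    -- A chord at an inner vertex is excluded by `neighbour`. If both positions are ends, they are
    -- different ends, since `K` has no loops.
    adjacency : ∀ i j → Adj K (vertex p i) (vertex p j) → Consecutive i j ⊎ Ends i j ⊎ Ends j i
    adjacency i j ij with neighbour i ij | neighbour j (symm K ij)
    ... | inj₂ (inj₂ (_ , e , c)) | _ with refl ← injective p e = inj₁ c
    ... | _ | inj₂ (inj₂ (_ , e , c)) with refl ← injective p e = inj₁ (swap c)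
      where swap = [ inj₂ , inj₁ ]′
    ... | inj₁ i≡0 | inj₁ j≡0 = contradiction ij (irrefl K (cong (vertex p) (trans i≡0 (sym j≡0))))
    ... | inj₁ i≡0 | inj₂ (inj₁ j≡m) = inj₂ (inj₂ (j≡m , i≡0))
    ... | inj₂ (inj₁ i≡m) | inj₁ j≡0 = inj₂ (inj₁ (i≡m , j≡0))
    ... | inj₂ (inj₁ i≡m) | inj₂ (inj₁ j≡m) = contradiction ij (irrefl K (cong (vertex p) (trans i≡m (sym j≡m))))

-- Recognising paths and cycles

numbering⇒≅ : ∀ {m n} (K : Graph n) (H : Graph m) (f : Fin m → Fin n) → (∀ {i j} → f i ≡ f j → i ≡ j) →
              (∀ v → ∃[ i ] f i ≡ v) → (∀ i j → Adj K (f i) (f j) ⇔ Adj H i j) → K ≅ H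
numbering⇒≅ K H f inj surj adj =
  mk↔ₛ′ g f (λ i → inj (proj₂ (surj (f i)))) (λ v → proj₂ (surj v)) ,
  λ u v → subst₂ (λ x y → Adj K x y ⇔ Adj H (g u) (g v)) (proj₂ (surj u)) (proj₂ (surj v)) (adj (g u) (g v))
  where
  g = λ v → proj₁ (surj v)

module _ {m} (K : Graph (suc m)) (unbranched : ¬ Branching K) (p : PathIn K m)
         (visited : ∀ v → PathIn.Visited p v) where
  open PathIn p

  private
    f-irrefl : ∀ i j → Adj K (vertex i) (vertex j) → i ≢ j
    f-irrefl i j ij i≡j = irrefl K (cong vertex i≡j) ij

  spanning-path⇒path⊎cycle : K ≅ pathGraph (suc m) ⊎ K ≅ cycleGraph (suc m)
  -- By `adjacency`, the edge between the two ends is the only one left open. On two vertices the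
  -- ends are adjacent and `cycleGraph 2` is a single edge.
  spanning-path⇒path⊎cycle with adj? K (vertex (fromℕ m)) (vertex zero)
  ... | no open-ended = inj₁ (numbering⇒≅ K (pathGraph (suc m)) vertex injective visited λ i j → mk⇔ (to i j) from)
    where
    to : ∀ i j → Adj K (vertex i) (vertex j) → Adj (pathGraph (suc m)) i j
    to i j ij with adjacency K unbranched p i j ij
    ... | inj₁ c                     = f-irrefl i j ij , c
    ... | inj₂ (inj₁ (refl , refl))  = contradiction ij open-ended
    ... | inj₂ (inj₂ (refl , refl))  = contradiction (symm K ij) open-ended
    from : ∀ {i j} → Adj (pathGraph (suc m)) i j → Adj K (vertex i) (vertex j)
    from (_ , inj₁ e) = step e
    from (_ , inj₂ e) = symm K (step e)
  ... | yes closed = inj₂ (numbering⇒≅ K (cycleGraph (suc m)) vertex injective visited λ i j → mk⇔ (to i j) from)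
    where
    to : ∀ i j → Adj K (vertex i) (vertex j) → Adj (cycleGraph (suc m)) i j
    to i j ij with adjacency K unbranched p i j ij
    ... | inj₁ (inj₁ c)             = f-irrefl i j ij , inj₁ (inj₁ c)
    ... | inj₁ (inj₂ c)             = f-irrefl i j ij , inj₂ (inj₁ c)
    ... | inj₂ (inj₁ (refl , refl)) = f-irrefl i j ij , inj₁ (inj₂ (cong suc (Finₚ.toℕ-fromℕ m) , refl))
    ... | inj₂ (inj₂ (refl , refl)) = f-irrefl i j ij , inj₂ (inj₂ (cong suc (Finₚ.toℕ-fromℕ m) , refl))
    wrap : ∀ {i j : Fin (suc m)} → suc (toℕ i) ≡ suc m → toℕ j ≡ 0 → Adj K (vertex i) (vertex j)
    wrap {i} {j} i≡m j≡0 = subst₂ (λ i j → Adj K (vertex i) (vertex j))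
      (Finₚ.toℕ-injective (trans (Finₚ.toℕ-fromℕ m) (sym (ℕₚ.suc-injective i≡m))))
      (Finₚ.toℕ-injective (sym j≡0)) closed
    from : ∀ {i j} → Adj (cycleGraph (suc m)) i j → Adj K (vertex i) (vertex j)
    from (_ , inj₁ (inj₁ e))       = step e
    from (_ , inj₁ (inj₂ (e , z))) = wrap e z
    from (_ , inj₂ (inj₁ e))       = symm K (step e)
    from (_ , inj₂ (inj₂ (e , z))) = symm K (wrap e z)

unbranched⇒path⊎cycle : ∀ {n} (K : Graph (suc n)) → Connected K → ¬ Branching K →
                        K ≅ pathGraph (suc n) ⊎ K ≅ cycleGraph (suc n)
unbranched⇒path⊎cycle {n} K connected unbranched
  with m , p , s , s′ ← maximal K (suc n) (ℕₚ.m≤m+n (suc n) 0) (singleton K zero)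
  with visited ← spanning K unbranched p connected s s′
  -- The numbering of the path is injective and hits every vertex, which forces its length to match
  -- the order of `K`.
  with refl ← ℕₚ.≤-antisym (Finₚ.injective⇒≤ (PathIn.injective p)) (Finₚ.injective⇒≤ (section-injective visited))
  = spanning-path⇒path⊎cycle K unbranched p visited

theorem2p5 : ∀ (n : ℕ) (K : Graph n) → 5 ≤ n → Connected K →
    ¬ (K ≅ pathGraph n) → ¬ (K ≅ cycleGraph n) →
    ABC (lineGraph K) <ℝ ABS (lineGraph K)
theorem2p5 (suc n) K 5≤n connected ¬path ¬cycle = go (branching? K)
  where
  go : Dec (Branching K) → ABC (lineGraph K) <ℝ ABS (lineGraph K)
  -- Without a branching vertex `K` is a path or a cycle, and both are excluded by hypothesis.
  go (no unbranched)  = contradiction (unbranched⇒path⊎cycle K connected unbranched) [ ¬path , ¬cycle ]′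
  go (yes branches) =
    let i , 3≤di = branching⇒3≤degree K 5≤n connected branches
    in discharging (lineGraph K) (lineGraph-clawFree K)
         (layering (lineGraph K) (lineGraph-connected K connected) i 3≤di) i 3≤di
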